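{- Let $G$ be a finite or infinite connected graph with maximum valence 3. Suppose $G$ has a vertex $v$ of valence 2 of type 1. Then $D(G)\le 2$ or $G$ is isomorphic to $S_n$ for some $n\ge2$.
   Context: For a vertex $v$, let $\mathrm{Aut}_v(G)$ be the stabilizer of $v$ in the automorphism group; it induces a permutation group on the neighbors of $v$, and the type of $v$ is the order of this permutation group (so a valence 2 vertex has type 1 if every automorphism fixing $v$ fixes both neighbors, type 2 otherwise). $D(G)$ is the least number of colors in a vertex coloring of $G$ whose only color-preserving automorphism is the identity. For $n\ge1$, $T_n$ is the finite tree in which every vertex has valence 1 or 3 and every leaf has distance exactly $n$ from a fixed root; for $n\ge2$, $S_n$ is obtained from $T_n$ by joining by an edge every two leaves having a common neighbor. -}

module Defs where

open import Data.Nat using (ℕ; zero; suc; _≤_; _<_)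
open import Data.Fin using (Fin)
open import Data.Bool using (Bool; true; false)
open import Data.List using (List; []; _∷_; length)
open import Data.List.Membership.Propositional using (_∈_)
open import Data.List.Relation.Unary.Unique.Propositional using (Unique)
open import Data.Product using (Σ; ∃; _×_; _,_)
open import Data.Sum using (_⊎_)
open import Relation.Nullary using (¬_)
open import Relation.Binary.PropositionalEquality using (_≡_)
open import Function.Bundles using (_↔_; _⇔_; Inverse)

record Graph : Set₁ where
  field
    V      : Set
    Adj    : V → V → Set
    sym    : ∀ {x y} → Adj x y → Adj y x
    irrefl : ∀ {x} → ¬ Adj x x
open Graph public

data Walk (G : Graph) : V G → V G → Set where
  here : ∀ {x} → Walk G x x
  step : ∀ {x y z} → Adj G x y → Walk G y z → Walk G x z

Connected : Graph → Set
Connected G = ∀ x y → Walk G x y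

HasValence : (G : Graph) → V G → ℕ → Set
HasValence G v k =
  Σ (List (V G)) λ ns → Unique ns × length ns ≡ k × (∀ w → Adj G v w ⇔ w ∈ ns)

MaxValence3 : Graph → Set
MaxValence3 G =
  (∀ v → Σ ℕ λ k → k ≤ 3 × HasValence G v k) × (Σ (V G) λ v → HasValence G v 3)

_≅_ : Graph → Graph → Set
G ≅ H = Σ (V G ↔ V H) λ φ →
  ∀ x y → Adj G x y ⇔ Adj H (Inverse.to φ x) (Inverse.to φ y)

Aut : Graph → Set
Aut G = G ≅ G

app : ∀ (G : Graph) → Aut G → V G → V G
app G (φ , _) = Inverse.to φ

-- Type 1 (for a vertex): the permutation group induced on the neighbours of v
-- by the stabiliser Aut_v(G) has order 1, i.e. every automorphism fixing v
-- fixes every neighbour of v.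
Type1 : (G : Graph) → V G → Set
Type1 G v = ∀ (f : Aut G) → app G f v ≡ v → ∀ w → Adj G v w → app G f w ≡ w

DistinguishingNumber≤2 : Graph → Set
DistinguishingNumber≤2 G =
  Σ (V G → Bool) λ c →
    ∀ (f : Aut G) → (∀ x → c (app G f x) ≡ c x) → ∀ x → app G f x ≡ x

-- The tree T_n: root, and for each vertex at depth d ≥ 1 a branch i ∈ Fin 3
-- together with a path p of d-1 binary choices (stored most recent first).
-- Leaves are at depth n, i.e. length p ≡ n - 1.
data TVtx (n : ℕ) : Set where
  root : TVtx n
  node : (i : Fin 3) (p : List Bool) → .(length p < n) → TVtx n

-- Directed edges of S_n: tree edges (parent → child) plus edges joining two
-- leaves (depth n) with a common neighbour (their common parent node i p,
-- which exists as a non-root vertex when n ≥ 2).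
data SEdge (n : ℕ) : TVtx n → TVtx n → Set where
  rootEdge  : ∀ i .(h : 0 < n) → SEdge n root (node i [] h)
  childEdge : ∀ i p b .(h : length p < n) .(h′ : suc (length p) < n) →
              SEdge n (node i p h) (node i (b ∷ p) h′)
  leafEdge  : ∀ i p .(h h′ : suc (length p) < n) → suc (suc (length p)) ≡ n →
              SEdge n (node i (false ∷ p) h) (node i (true ∷ p) h′)

SAdj : (n : ℕ) → TVtx n → TVtx n → Set
SAdj n x y = SEdge n x y ⊎ SEdge n y x

S-irrefl : ∀ n {x} → ¬ SAdj n x x
S-irrefl n (Data.Sum.inj₁ ())
S-irrefl n (Data.Sum.inj₂ ())

S-sym : ∀ n {x y} → SAdj n x y → SAdj n y x
S-sym n (Data.Sum.inj₁ e) = Data.Sum.inj₂ e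
S-sym n (Data.Sum.inj₂ e) = Data.Sum.inj₁ e

S : ℕ → Graph
S n = record { V = TVtx n ; Adj = SAdj n ; sym = S-sym n ; irrefl = S-irrefl n }

{-# OPTIONS --safe #-}
module Submission where

-- Arrange the vertices by their distance from v. Away from v every vertex has at most two
-- children, so an automorphism fixing all smaller levels can only exchange pairs of twins
-- (vertices with the same parents). Colouring one vertex of each such pair black therefore
-- kills every automorphism that fixes v, since type 1 makes these fix the neighbours a, b of v.
-- It remains to choose the black vertices so that v can be recognised.
--
-- Unless v lies in a triangle v, a, b with another vertex of valence 2, colour v, a, b black as
-- well. By a careful choice within the twin pairs, v becomes the only black vertex of valence 2
-- all of whose neighbours are black; the one obstruction is K_{2,3}, where v is not of type 1.
--
-- If v, a have valence 2 and v, a, b is a triangle, climb from b as long as the vertex reached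
-- carries two branches of the same height (binary trees with sibling leaves joined) and one
-- further edge. If a vertex with three equal branches is met, the graph is S_n. Otherwise
-- colour the ray climbed black and its side branches' roots white. The image of the ray under an
-- automorphism not fixing v would lead towards v: impossible if the ray is infinite, and
-- excluded by the colours of twins at its top if it is finite.

open import Defs
open import Data.Bool using (Bool; true; false; not)
open import Data.Empty using (⊥; ⊥-elim)
open import Data.Fin as Fin using (Fin)
open import Data.Fin.Properties using (pigeonhole)
open import Data.List using (List; []; _∷_; _++_; length; lookup; concatMap)
open import Data.List.Membership.Propositional using (_∈_; find; lose)
open import Data.List.Membership.Propositional.Properties using (∈-concatMap⁺; ∈-++⁺ˡ; ∈-++⁺ʳ; ∈-lookup)
open import Data.List.Relation.Unary.All as All using (All; []; _∷_; all?)
open import Data.List.Relation.Unary.AllPairs using ([]; _∷_)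
open import Data.List.Relation.Unary.Any as Any using (here; there; any?)
open import Data.List.Relation.Unary.Any.Properties using (lookup-index)
open import Data.List.Relation.Unary.Unique.Propositional using (Unique)
open import Data.Nat using (ℕ; zero; suc; _+_; _∸_; _≤_; _<_; z≤n; s≤s; _≤?_; _<?_)
import Data.Nat as ℕ
open import Data.Nat.Binary using (ℕᵇ; 2[1+_]; 1+[2_])
import Data.Nat.Binary as ℕᵇ
import Data.Nat.Binary.Properties as ℕᵇₚ
open import Data.Nat.Induction using (<-rec)
open import Data.Nat.Properties hiding (_≟_; _≤?_; _<?_)
open import Data.Product using (Σ; ∃; ∃₂; _×_; _,_; proj₁; proj₂)
open import Data.Sum using (_⊎_; inj₁; inj₂; [_,_]′; swap)
open import Data.Unit using (⊤; tt)
open import Function.Base using (_∘_)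
open import Function.Bundles using (Inverse; Equivalence; mk⇔; mk↔ₛ′)
open import Relation.Binary.Definitions using (tri<; tri≈; tri>)
open import Relation.Binary.PropositionalEquality using (_≡_; _≢_; refl; cong; subst; subst₂; trans) renaming (sym to ≡sym)
open import Relation.Nullary using (¬_; Dec; yes; no; does; contradiction)
open import Relation.Nullary.Decidable using (map′; _×-dec_; _⊎-dec_; _→-dec_; ¬?; decidable-stable; dec-true; recompute)
open import Relation.Unary using (Decidable)

-- Finite searches, least witnesses and the pigeonhole principle

∃∈? : {A : Set} {P : A → Set} → Decidable P → (l : List A) → Dec (∃ λ x → x ∈ l × P x)
∃∈? P? l = map′ find (λ (_ , m , p) → lose m p) (any? P? l)

∀∈? : {A : Set} {P : A → Set} → Decidable P → (l : List A) → Dec (∀ x → x ∈ l → P x)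
∀∈? P? l = map′ (λ ps _ m → All.lookup ps m) (λ h → All.tabulate (h _)) (all? P? l)

holds : {P : Set} (d : Dec P) → does d ≡ true → P
holds (yes p) _ = p

least : {P : ℕ → Set} → Decidable P → ∀ n → P n → ∃ λ m → P m × (∀ k → k < m → ¬ P k)
least P? n p with P? 0
... | yes p₀ = 0 , p₀ , λ _ ()
least P? zero p | no ¬p₀ = contradiction p ¬p₀
least P? (suc n) p | no ¬p₀ =
  let m , pm , below = least (P? ∘ suc) n p
  in suc m , pm , λ { zero _ → ¬p₀ ; (suc k) (s≤s k<m) → below k k<m }

unique-lookup : {A : Set} {xs : List A} → Unique xs → ∀ i j → i Fin.< j → lookup xs i ≢ lookup xs j
unique-lookup (px ∷ _) Fin.zero (Fin.suc j) _ = All.lookup px (∈-lookup j)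
unique-lookup (_ ∷ u) (Fin.suc i) (Fin.suc j) (s≤s i<j) = unique-lookup u i j i<j

unique-length : {A : Set} {xs ys : List A} → Unique xs → All (_∈ ys) xs → length xs ≤ length ys
unique-length {xs = xs} {ys} u sub = ≮⇒≥ λ short →
  let i , j , i<j , eq = pigeonhole short (λ i → Any.index (All.lookup sub (∈-lookup i)))
  in unique-lookup u i j i<j (trans (at i) (trans (cong (lookup ys) eq) (≡sym (at j))))
  where
  at : ∀ i → lookup xs i ≡ lookup ys (Any.index (All.lookup sub (∈-lookup i)))
  at i = lookup-index (All.lookup sub (∈-lookup i))

-- A connected graph of valence at most 3 with a root

module Rooted (G : Graph) (conn : Connected G)
  (mv : ∀ x → Σ ℕ λ k → k ≤ 3 × HasValence G x k) (v : V G) where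

  X : Set
  X = V G

  infix 4 _~_
  _~_ : X → X → Set
  _~_ = Adj G

  ~sym : ∀ {x y} → x ~ y → y ~ x
  ~sym = sym G

  ~≢ : ∀ {x y} → x ~ y → x ≢ y
  ~≢ e refl = irrefl G e

  nb : X → List X
  nb x = proj₁ (proj₂ (proj₂ (mv x)))

  nb⁺ : ∀ {x y} → x ~ y → y ∈ nb x
  nb⁺ {x} {y} = Equivalence.to (proj₂ (proj₂ (proj₂ (proj₂ (proj₂ (mv x))))) y)

  nb⁻ : ∀ {x y} → y ∈ nb x → x ~ y
  nb⁻ {x} {y} = Equivalence.from (proj₂ (proj₂ (proj₂ (proj₂ (proj₂ (mv x))))) y)

  nb-length : ∀ x → length (nb x) ≤ 3
  nb-length x = subst (_≤ 3) (≡sym (proj₁ (proj₂ (proj₂ (proj₂ (proj₂ (mv x))))))) (proj₁ (proj₂ (mv x)))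

  -- A walk from the root is recorded by the positions of its steps in the neighbour
  -- lists; this makes equality and adjacency decidable and well-orders the vertices.

  encode-∈ : ∀ {y : X} {l} → y ∈ l → ℕᵇ → ℕᵇ
  encode-∈ (here _) n = 2[1+ n ]
  encode-∈ (there m) n = 1+[2 encode-∈ m n ]

  encode : ∀ {x y} → Walk G x y → ℕᵇ
  encode Walk.here = ℕᵇ.zero
  encode (step e w) = encode-∈ (nb⁺ e) (encode w)

  -- Each `1+[2_]` skips one list entry and `2[1+_]` ends the step, so the digits of successive
  -- steps cannot run together.
  encode-∈-injective : ∀ {y z : X} {l} (y∈ : y ∈ l) (z∈ : z ∈ l) {m n} →
    encode-∈ y∈ m ≡ encode-∈ z∈ n → y ≡ z × m ≡ n
  encode-∈-injective (here refl) (here refl) refl = refl , refl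
  encode-∈-injective (there y∈) (there z∈) eq = encode-∈-injective y∈ z∈ (ℕᵇₚ.1+[2_]-injective eq)

  encode-∈≢zero : ∀ {y : X} {l} (y∈ : y ∈ l) {n} → encode-∈ y∈ n ≢ ℕᵇ.zero
  encode-∈≢zero (here _) ()
  encode-∈≢zero (there _) ()

  encode-injective : ∀ {x y z} (w : Walk G x y) (w′ : Walk G x z) → encode w ≡ encode w′ → y ≡ z
  encode-injective Walk.here Walk.here _ = refl
  encode-injective Walk.here (step e _) eq = contradiction (≡sym eq) (encode-∈≢zero (nb⁺ e))
  encode-injective (step e _) Walk.here eq = contradiction eq (encode-∈≢zero (nb⁺ e))
  encode-injective (step e w) (step e′ w′) eq with encode-∈-injective (nb⁺ e) (nb⁺ e′) eq
  ... | refl , eq′ = encode-injective w w′ eq′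

  infix 4 _≟_ _~?_

  abstract
    code : X → ℕ
    code x = ℕᵇ.toℕ (encode (conn v x))

    code-injective : ∀ {x y} → code x ≡ code y → x ≡ y
    code-injective {x} {y} eq = encode-injective (conn v x) (conn v y) (ℕᵇₚ.toℕ-injective eq)

    _≟_ : (x y : X) → Dec (x ≡ y)
    x ≟ y = map′ code-injective (cong code) (code x ℕ.≟ code y)

  _~?_ : (x y : X) → Dec (x ~ y)
  x ~? y = map′ nb⁻ nb⁺ (y ∈? nb x)
    where open import Data.List.Membership.DecPropositional _≟_ using (_∈?_)

  -- Vertices of valence 2 and 3

  record N2 (x y z : X) : Set where
    constructor n2
    field
      y≢z  : y ≢ z
      ~y   : x ~ y
      ~z   : x ~ z
      only : ∀ w → x ~ w → w ≡ y ⊎ w ≡ z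

  record N3 (x p y z : X) : Set where
    constructor n3
    field
      p≢y : p ≢ y
      p≢z : p ≢ z
      y≢z : y ≢ z
      ~p  : x ~ p
      ~y  : x ~ y
      ~z  : x ~ z

  four : ∀ {x a b c d} → x ~ a → x ~ b → x ~ c → x ~ d →
    a ≢ b → a ≢ c → a ≢ d → b ≢ c → b ≢ d → c ≢ d → ⊥
  four {x} ea eb ec ed ab ac ad bc bd cd = <-irrefl refl (≤-trans (unique-length
    ((ab ∷ ac ∷ ad ∷ []) ∷ (bc ∷ bd ∷ []) ∷ (cd ∷ []) ∷ [] ∷ [])
    (nb⁺ ea ∷ nb⁺ eb ∷ nb⁺ ec ∷ nb⁺ ed ∷ [])) (nb-length x))

  only3 : ∀ {x p y z} → N3 x p y z → ∀ w → x ~ w → w ≡ p ⊎ w ≡ y ⊎ w ≡ z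
  only3 {p = p} {y} {z} (n3 py pz yz ep ey ez) w ew with w ≟ p | w ≟ y | w ≟ z
  ... | yes e | _ | _ = inj₁ e
  ... | no _ | yes e | _ = inj₂ (inj₁ e)
  ... | no _ | no _ | yes e = inj₂ (inj₂ e)
  ... | no wp | no wy | no wz = ⊥-elim (four ew ep ey ez wp wy wz py pz yz)

  N2-swap : ∀ {x y z} → N2 x y z → N2 x z y
  N2-swap (n2 yz ey ez o) = n2 (yz ∘ ≡sym) ez ey λ w e → swap (o w e)

  N3-swap : ∀ {x p y z} → N3 x p y z → N3 x p z y
  N3-swap (n3 py pz yz ep ey ez) = n3 pz py (yz ∘ ≡sym) ep ez ey

  N2-other : ∀ {x y z w} → N2 x y z → x ~ w → w ≢ y → w ≡ z
  N2-other n e w≢y with N2.only n _ e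
  ... | inj₁ w≡y = contradiction w≡y w≢y
  ... | inj₂ w≡z = w≡z

  N2-N3 : ∀ {x y z a b c} → N2 x y z → N3 x a b c → ⊥
  N2-N3 (n2 _ _ _ o) (n3 ab ac bc ea eb ec) with o _ ea | o _ eb | o _ ec
  ... | inj₁ refl | inj₁ refl | _ = ab refl
  ... | inj₁ refl | inj₂ refl | inj₁ refl = ac refl
  ... | inj₁ refl | inj₂ refl | inj₂ refl = bc refl
  ... | inj₂ refl | inj₂ refl | _ = ab refl
  ... | inj₂ refl | inj₁ refl | inj₁ refl = bc refl
  ... | inj₂ refl | inj₁ refl | inj₂ refl = ac refl

  N2? : ∀ x y z → Dec (N2 x y z)
  N2? x y z = map′ (λ (ne , ey , ez , o) → n2 ne ey ez λ w e → o w (nb⁺ e))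
    (λ (n2 ne ey ez o) → ne , ey , ez , λ w m → o w (nb⁻ m))
    (¬? (y ≟ z) ×-dec x ~? y ×-dec x ~? z ×-dec ∀∈? (λ w → (w ≟ y) ⊎-dec (w ≟ z)) (nb x))

  N3? : ∀ x p y z → Dec (N3 x p y z)
  N3? x p y z = map′ (λ (a , b , c , d , e , f) → n3 a b c d e f) (λ (n3 a b c d e f) → a , b , c , d , e , f)
    (¬? (p ≟ y) ×-dec ¬? (p ≟ z) ×-dec ¬? (y ≟ z) ×-dec x ~? p ×-dec x ~? y ×-dec x ~? z)

  ∃~? : ∀ {P : X → Set} → Decidable P → ∀ x → Dec (∃ λ y → x ~ y × P y)
  ∃~? P? x = map′ (λ (y , m , p) → y , nb⁻ m , p) (λ (y , e , p) → y , nb⁺ e , p) (∃∈? P? (nb x))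

  ∀~? : ∀ {P : X → Set} → Decidable P → ∀ x → Dec (∀ y → x ~ y → P y)
  ∀~? P? x = map′ (λ h y e → h y (nb⁺ e)) (λ h y m → h y (nb⁻ m)) (∀∈? P? (nb x))

  Val2 : X → Set
  Val2 x = ∃₂ λ y z → N2 x y z

  Val2? : Decidable Val2
  Val2? x = map′ (λ (y , _ , z , _ , n) → y , z , n) (λ (y , z , n) → y , N2.~y n , z , N2.~z n , n)
    (∃~? (λ y → ∃~? (λ z → N2? x y z) x) x)

  -- Distance from the root

  Reach : ℕ → X → Set
  Reach zero x = x ≡ v
  Reach (suc n) x = Reach n x ⊎ ∃ λ y → x ~ y × Reach n y

  Reach? : ∀ n → Decidable (Reach n)
  Reach? zero x = x ≟ v
  Reach? (suc n) x = Reach? n x ⊎-dec ∃~? (Reach? n) x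

  reachable : ∀ {x} → Walk G x v → ∃ λ n → Reach n x
  reachable Walk.here = 0 , refl
  reachable (step e w) = let n , r = reachable w in suc n , inj₂ (_ , e , r)

  abstract
    nearest : ∀ x → ∃ λ m → Reach m x × (∀ k → k < m → ¬ Reach k x)
    nearest x = let n , r = reachable (conn x v) in least (λ n → Reach? n x) n r

  ℓ : X → ℕ
  ℓ x = proj₁ (nearest x)

  ℓ-reach : ∀ x → Reach (ℓ x) x
  ℓ-reach x = proj₁ (proj₂ (nearest x))

  ℓ-min : ∀ {x n} → Reach n x → ℓ x ≤ n
  ℓ-min {x} r = ≮⇒≥ λ lt → proj₂ (proj₂ (nearest x)) _ lt r

  ℓv : ℓ v ≡ 0
  ℓv = n≤0⇒n≡0 (ℓ-min refl)

  ℓ≡0 : ∀ {x} → ℓ x ≡ 0 → x ≡ v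
  ℓ≡0 {x} eq = subst (λ n → Reach n x) eq (ℓ-reach x)

  ℓ-adj : ∀ {x y} → x ~ y → ℓ x ≤ suc (ℓ y)
  ℓ-adj e = ℓ-min (inj₂ (_ , e , ℓ-reach _))

  Par : X → X → Set
  Par x p = x ~ p × ℓ x ≡ suc (ℓ p)

  Par? : ∀ x p → Dec (Par x p)
  Par? x p = x ~? p ×-dec ℓ x ℕ.≟ suc (ℓ p)

  ∀Par? : ∀ {P : X → Set} → Decidable P → ∀ x → Dec (∀ p → Par x p → P p)
  ∀Par? P? x = map′ (λ h p a → h p (proj₁ a) a) (λ h p _ → h p) (∀~? (λ p → Par? x p →-dec P? p) x)

  parent : ∀ {x} → x ≢ v → ∃ (Par x)
  parent {x} x≢v with ℓ x in eq | ℓ-reach x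
  ... | zero | r = contradiction r x≢v
  ... | suc n | inj₁ r = contradiction (≤-trans (≤-reflexive (≡sym eq)) (ℓ-min r)) (<-irrefl refl)
  ... | suc n | inj₂ (y , e , r) = y , e ,
    cong suc (≤-antisym (≤-pred (≤-trans (≤-reflexive (≡sym eq)) (ℓ-adj e))) (ℓ-min r))

  ℓ>0⇒≢v : ∀ {x} → 0 < ℓ x → x ≢ v
  ℓ>0⇒≢v 0<ℓ refl = <-irrefl (≡sym ℓv) 0<ℓ

  ℓ<⇒≢ : ∀ {x y} → ℓ x < ℓ y → x ≢ y
  ℓ<⇒≢ lt refl = <-irrefl refl lt

  Par-< : ∀ {x p} → Par x p → ℓ p < ℓ x
  Par-< (_ , eq) = ≤-reflexive (≡sym eq)

  Par-asym : ∀ {x p} → Par x p → ¬ Par p x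
  Par-asym a b = <-asym (Par-< a) (Par-< b)

  compare : ∀ {x y} → x ~ y → Par x y ⊎ ℓ x ≡ ℓ y ⊎ Par y x
  compare {x} {y} e with <-cmp (ℓ x) (ℓ y)
  ... | tri< lt _ _ = inj₂ (inj₂ (~sym e , ≤-antisym (ℓ-adj (~sym e)) lt))
  ... | tri≈ _ eq _ = inj₂ (inj₁ eq)
  ... | tri> _ _ gt = inj₁ (e , ≤-antisym (ℓ-adj e) gt)

  ℓ≤1 : ∀ {x} → ℓ x ≤ 1 → x ≡ v ⊎ v ~ x
  ℓ≤1 {x} le with x ≟ v
  ... | yes eq = inj₁ eq
  ... | no ne with parent ne
  ... | p , e , eq with ℓ≡0 (n≤0⇒n≡0 (≤-pred (subst (_≤ 1) eq le)))
  ... | refl = inj₂ (~sym e)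

  ℓ-nb : ∀ {x} → v ~ x → ℓ x ≤ 1
  ℓ-nb e = subst (λ n → ℓ _ ≤ suc n) ℓv (ℓ-adj (~sym e))

  -- Automorphisms and their effect on levels

  record Au : Set where
    field
      f g : X → X
      fg  : ∀ x → f (g x) ≡ x
      gf  : ∀ x → g (f x) ≡ x
      f~  : ∀ {x y} → x ~ y → f x ~ f y
      g~  : ∀ {x y} → x ~ y → g x ~ g y

    f-inj : ∀ {x y} → f x ≡ f y → x ≡ y
    f-inj eq = trans (≡sym (gf _)) (trans (cong g eq) (gf _))

    preimage : ∀ {x w} → f x ~ w → x ~ g w
    preimage e = subst (_~ _) (gf _) (g~ e)

    N2-f : ∀ {x y z} → N2 x y z → N2 (f x) (f y) (f z)
    N2-f (n2 ne ey ez o) = n2 (ne ∘ f-inj) (f~ ey) (f~ ez) λ w e →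
      [ (λ eq → inj₁ (move eq)) , (λ eq → inj₂ (move eq)) ]′ (o (g w) (preimage e))
      where
      move : ∀ {w y} → g w ≡ y → w ≡ f y
      move {w} eq = trans (≡sym (fg w)) (cong f eq)

    N3-f : ∀ {x p y z} → N3 x p y z → N3 (f x) (f p) (f y) (f z)
    N3-f (n3 a b c d e h) = n3 (a ∘ f-inj) (b ∘ f-inj) (c ∘ f-inj) (f~ d) (f~ e) (f~ h)

    Val2-f : ∀ {x} → Val2 x → Val2 (f x)
    Val2-f (y , z , n) = f y , f z , N2-f n

    ℓ-f-≤ : f v ≡ v → ∀ n x → ℓ x ≡ n → ℓ (f x) ≤ n
    ℓ-f-≤ fv zero x eq = ≤-reflexive (trans (cong ℓ (trans (cong f (ℓ≡0 eq)) fv)) ℓv)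
    ℓ-f-≤ fv (suc n) x eq with parent {x} (ℓ>0⇒≢v (subst (0 <_) (≡sym eq) (s≤s z≤n)))
    ... | p , e , eq′ = ≤-trans (ℓ-adj (f~ e)) (s≤s (ℓ-f-≤ fv n p (suc-injective (trans (≡sym eq′) eq))))

  inv : Au → Au
  inv A = record { f = g ; g = f ; fg = gf ; gf = fg ; f~ = g~ ; g~ = f~ } where open Au A

  ℓ-f : (A : Au) → Au.f A v ≡ v → ∀ x → ℓ (Au.f A x) ≡ ℓ x
  ℓ-f A fv x = ≤-antisym (ℓ-f-≤ fv _ x refl)
    (subst (λ y → ℓ y ≤ ℓ (f x)) (gf x) (Au.ℓ-f-≤ (inv A) (trans (cong g (≡sym fv)) (gf v)) _ (f x) refl))
    where open Au A

  Par-f : (A : Au) → Au.f A v ≡ v → ∀ {x p} → Par x p → Par (Au.f A x) (Au.f A p)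
  Par-f A fv {x} {p} (e , eq) = Au.f~ A e , trans (ℓ-f A fv x) (trans eq (cong suc (≡sym (ℓ-f A fv p))))

  fromAut : Aut G → Au
  fromAut (φ , h) = record
    { f = Inverse.to φ ; g = Inverse.from φ
    ; fg = Inverse.strictlyInverseˡ φ ; gf = Inverse.strictlyInverseʳ φ
    ; f~ = λ e → Equivalence.to (h _ _) e
    ; g~ = λ e → Equivalence.from (h _ _)
        (subst₂ _~_ (≡sym (Inverse.strictlyInverseˡ φ _)) (≡sym (Inverse.strictlyInverseˡ φ _)) e) }

  toAut : Au → Aut G
  toAut A = mk↔ₛ′ f g fg gf , λ x y → mk⇔ f~ λ e → subst₂ _~_ (gf x) (gf y) (g~ e)
    where open Au A

  ball-fixed : Type1 G v → (A : Au) → Au.f A v ≡ v → ∀ x → ℓ x ≤ 1 → Au.f A x ≡ x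
  ball-fixed t1 A fv x le with ℓ≤1 le
  ... | inj₁ refl = fv
  ... | inj₂ e = t1 (toAut A) fv x e

  -- Twins: the only vertices that an automorphism fixing all smaller levels could exchange

  Tw : X → X → Set
  Tw x y = x ≢ y × 2 ≤ ℓ x × ℓ x ≡ ℓ y × (∀ p → Par x p → Par y p) × (∀ p → Par y p → Par x p)

  Tw? : ∀ x y → Dec (Tw x y)
  Tw? x y = ¬? (x ≟ y) ×-dec 2 ≤? ℓ x ×-dec ℓ x ℕ.≟ ℓ y
    ×-dec ∀Par? (Par? y) x ×-dec ∀Par? (Par? x) y

  Tw-sym : ∀ {x y} → Tw x y → Tw y x
  Tw-sym (ne , l , eq , h , k) = ne ∘ ≡sym , subst (2 ≤_) eq l , ≡sym eq , k , h

  Tw-par : ∀ {x y p} → Tw x y → Par x p → Par y p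
  Tw-par (_ , _ , _ , h , _) a = h _ a

  level2-parent : ∀ {x} → 2 ≤ ℓ x → ∃ λ p → Par x p × p ≢ v
  level2-parent 2≤ = let p , a = parent (ℓ>0⇒≢v (<⇒≤ 2≤))
    in p , a , ℓ>0⇒≢v (≤-pred (subst (2 ≤_) (proj₂ a) 2≤))

  -- A common parent lies beyond level 0 and has a parent of its own; valence 3 leaves it at most
  -- two children.
  Tw-unique : ∀ {x y z} → Tw x y → Tw x z → y ≡ z
  Tw-unique {x} {y} {z} t u with y ≟ z
  ... | yes eq = eq
  ... | no y≢z = ⊥-elim (four (proj₁ b) (~sym (proj₁ a)) (~sym (proj₁ (Tw-par t a))) (~sym (proj₁ (Tw-par u a)))
      (above a) (above (Tw-par t a)) (above (Tw-par u a)) (proj₁ t) (proj₁ u) y≢z)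
    where
    p = proj₁ (level2-parent (proj₁ (proj₂ t)))
    a : Par x p
    a = proj₁ (proj₂ (level2-parent (proj₁ (proj₂ t))))
    q = proj₁ (parent (proj₂ (proj₂ (level2-parent (proj₁ (proj₂ t))))))
    b : Par p q
    b = proj₂ (parent (proj₂ (proj₂ (level2-parent (proj₁ (proj₂ t))))))
    above : ∀ {w} → Par w p → q ≢ w
    above c = ℓ<⇒≢ (<-trans (Par-< b) (Par-< c))

  -- The parents of `x` lie on a smaller level and are fixed, so they are parents of `f x`; the
  -- inverse gives the converse.
  moved-Tw : (A : Au) → let open Au A in f v ≡ v →
    ∀ x → 2 ≤ ℓ x → (∀ y → ℓ y < ℓ x → f y ≡ y) → f x ≢ x → Tw x (f x)
  moved-Tw A fv x 2≤ below fx≢x = fx≢x ∘ ≡sym , 2≤ , ≡sym (ℓ-f A fv x) ,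
    (λ p a → subst (Par (f x)) (below p (Par-< a)) (Par-f A fv a)) ,
    (λ p a → subst₂ Par (gf x) (trans (cong g (≡sym (below p (subst (_ <_) (ℓ-f A fv x) (Par-< a))))) (gf p))
      (Par-f (inv A) (trans (cong g (≡sym fv)) (gf v)) a))
    where open Au A

  near : X → List X
  near x = concatMap nb (nb x)

  near⁺ : ∀ {x p y} → x ~ p → p ~ y → y ∈ near x
  near⁺ {x} e e′ = ∈-concatMap⁺ nb {xs = nb x} (lose (nb⁺ e) (nb⁺ e′))

  Tw-near : ∀ {x y} → Tw x y → y ∈ near x
  Tw-near t = let p , a , _ = level2-parent (proj₁ (proj₂ t)) in near⁺ (proj₁ a) (~sym (proj₁ (Tw-par t a)))

  -- Colourings that tell twins apart

  record Scheme : Set₁ where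
    field
      Sp     : X → Set
      Sp?    : Decidable Sp
      T      : X → X → Set
      T?     : ∀ x y → Dec (T x y)
      T⇒Tw   : ∀ {x y} → T x y → Tw x y
      T-sym  : ∀ {x y} → T x y → T y x
      T⇒¬Sp  : ∀ {x y} → T x y → ¬ Sp x
      L      : X → X → Set
      L?     : ∀ x s → Dec (L x s)
      L-near : ∀ {x s} → L x s → s ∈ nb x ++ near x
      L-ℓ    : ∀ {x s} → L x s → ℓ x ≡ ℓ s
      L-irr  : ∀ {x} → ¬ L x x

    -- Suppose an automorphism fixing all smaller levels exchanges `x` with `y`, and `y` is not
    -- linked to `s`. Then `s` is exchanged with its own twin, which is not linked to `x`; if `s`
    -- has the smaller code, breaking the symmetry can be left to it.
    Sees : X → X → X → Set
    Sees x y s = L x s → L y s ⊎ (code x < code s × (∀ t → T s t → ¬ L x t))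

    -- Black is the member of a twin pair with the smaller code, unless it is linked to a
    -- vertex that has to break the same symmetry and comes first.
    Black : X → Set
    Black x = Sp x ⊎ ∃ λ y → T x y × code x < code y × (∀ s → Sees x y s)

    Black? : Decidable Black
    Black? x = Sp? x ⊎-dec map′ (λ (y , _ , r) → y , r) (λ (y , t , r) → y , Tw-near (T⇒Tw t) , t , r)
      (∃∈? (λ y → T? x y ×-dec code x <? code y ×-dec
        map′ (λ h s l → h s (L-near l) l) (λ h s _ → h s) (∀∈? (Sees? y) (nb x ++ near x))) (near x))
      where
      Sees? : ∀ y s → Dec (Sees x y s)
      Sees? y s = L? x s →-dec (L? y s ⊎-dec (code x <? code s ×-dec
        map′ (λ h t τ → h t (Tw-near (T⇒Tw τ)) τ) (λ h t _ → h t)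
          (∀∈? (λ t → T? s t →-dec ¬? (L? x t)) (near s))))

    colour : X → Bool
    colour x = does (Black? x)

    colour-Black : (A : Au) → (∀ x → colour (Au.f A x) ≡ colour x) → ∀ {x} → Black x → Black (Au.f A x)
    colour-Black A pres {x} b = holds (Black? (Au.f A x)) (trans (pres x) (dec-true (Black? x) b))

    T-unique : ∀ {x y z} → T x y → T x z → y ≡ z
    T-unique t u = Tw-unique (T⇒Tw t) (T⇒Tw u)

    -- If some vertex of a level is moved while all smaller levels are fixed, the moved vertex
    -- of least code is black and its image is not.
    rigid : (A : Au) → let open Au A in
      (∀ {x} → Black x → Black (f x)) →
      (∀ {x s} → L x s → L (f x) (f s)) →
      (∀ x → 2 ≤ ℓ x → (∀ y → ℓ y < ℓ x → f y ≡ y) → f x ≢ x → T x (f x)) →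
      (∀ x → ℓ x ≤ 1 → f x ≡ x) →
      ∀ x → f x ≡ x
    rigid A pres L-f twin base x = fixed (ℓ x) x ≤-refl
      where
      open Au A
      level : ∀ k → (∀ z → ℓ z ≤ suc k → f z ≡ z) → ∀ n → (∀ {m} → m < n → ∀ x → code x ≡ m → ℓ x ≡ 2 + k → f x ≡ x) →
        ∀ x → code x ≡ n → ℓ x ≡ 2 + k → f x ≡ x
      level k below _ rec x refl eq with f x ≟ x
      ... | yes fx = fx
      ... | no fx≢x = ⊥-elim (white (pres black))
        where
        T-f : ∀ {y} → ℓ y ≡ 2 + k → f y ≢ y → T y (f y)
        T-f {y} eq = twin y (subst (2 ≤_) (≡sym eq) (s≤s (s≤s z≤n)))
          λ z lt → below z (≤-pred (subst (suc (ℓ z) ≤_) eq lt))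
        ℓ-f′ : ∀ {y} → ℓ y ≡ 2 + k → f y ≢ y → ℓ (f y) ≡ 2 + k
        ℓ-f′ eq ne = trans (≡sym (proj₁ (proj₂ (proj₂ (T⇒Tw (T-f eq ne)))))) eq
        ff : ∀ {y} → ℓ y ≡ 2 + k → f y ≢ y → f (f y) ≡ y
        ff eq ne = T-unique (T-f (ℓ-f′ eq ne) (ne ∘ f-inj)) (T-sym (T-f eq ne))
        first : ∀ {y} → ℓ y ≡ 2 + k → f y ≢ y → x ≢ y → code x < code y
        first {y} eq ne x≢y with <-cmp (code x) (code y)
        ... | tri< lt _ _ = lt
        ... | tri≈ _ same _ = contradiction (code-injective same) x≢y
        ... | tri> _ _ gt = contradiction (rec gt y refl eq) ne
        x<fx : code x < code (f x)
        x<fx = first (ℓ-f′ eq fx≢x) (fx≢x ∘ f-inj) (fx≢x ∘ ≡sym)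
        black : Black x
        black = inj₂ (f x , T-f eq fx≢x , x<fx , sees)
          where
          sees : ∀ s → Sees x (f x) s
          sees s l with L? (f x) s
          ... | yes l′ = inj₁ l′
          -- `s` is moved, as otherwise `L-f` would link `f x` to `s`; a link from `x` to the twin
          -- `f s` would be mapped to that same link.
          ... | no ¬l′ = inj₂ (first s-eq fs≢s (λ { refl → L-irr l }) , λ t τ l″ →
              ¬l′ (subst (L (f x)) (trans (cong f (T-unique τ (T-f s-eq fs≢s))) (ff s-eq fs≢s)) (L-f l″)))
            where
            s-eq : ℓ s ≡ 2 + k
            s-eq = trans (≡sym (L-ℓ l)) eq
            fs≢s : f s ≢ s
            fs≢s fs = ¬l′ (subst (L (f x)) fs (L-f l))
        white : ¬ Black (f x)
        white (inj₁ sp) = T⇒¬Sp (T-sym (T-f eq fx≢x)) sp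
        white (inj₂ (z , τ , lt , _)) with T-unique τ (T-sym (T-f eq fx≢x))
        ... | refl = <-asym lt x<fx
      fixed : ∀ k x → ℓ x ≤ k → f x ≡ x
      fixed zero x ≤k = base x (≤-trans ≤k z≤n)
      fixed (suc zero) x ≤k = base x ≤k
      fixed (suc (suc k)) x ≤k = [ (λ lt → fixed (suc k) x (≤-pred lt))
        , <-rec (λ n → ∀ x → code x ≡ n → ℓ x ≡ 2 + k → f x ≡ x) (level k (fixed (suc k))) _ x refl ]′
        (m≤n⇒m<n∨m≡n ≤k)

    distinguishing : (∀ (A : Au) → (∀ {x} → Black x → Black (Au.f A x)) → ∀ x → Au.f A x ≡ x) →
      DistinguishingNumber≤2 G
    distinguishing h = colour , λ φ pres → h (fromAut φ) (colour-Black (fromAut φ) pres)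

  -- Interchanging two vertices with the same neighbours

  module Interchange {p q : X} (p⊆q : ∀ w → p ~ w → q ~ w) (q⊆p : ∀ w → q ~ w → p ~ w) where

    τ : X → X
    τ x with x ≟ p | x ≟ q
    ... | yes _ | _ = q
    ... | no _ | yes _ = p
    ... | no _ | no _ = x

    τp : τ p ≡ q
    τp with p ≟ p | p ≟ q
    ... | yes _ | _ = refl
    ... | no p≢p | _ = contradiction refl p≢p

    τq : τ q ≡ p
    τq with q ≟ p | q ≟ q
    ... | yes q≡p | _ = q≡p
    ... | no _ | yes _ = refl
    ... | no _ | no q≢q = contradiction refl q≢q

    τ-else : ∀ {x} → x ≢ p → x ≢ q → τ x ≡ x
    τ-else {x} x≢p x≢q with x ≟ p | x ≟ q
    ... | yes x≡p | _ = contradiction x≡p x≢p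
    ... | no _ | yes x≡q = contradiction x≡q x≢q
    ... | no _ | no _ = refl

    ττ : ∀ x → τ (τ x) ≡ x
    ττ x = go (x ≟ p) (x ≟ q)
      where
      go : Dec (x ≡ p) → Dec (x ≡ q) → τ (τ x) ≡ x
      go (yes refl) _ = trans (cong τ τp) τq
      go (no _) (yes refl) = trans (cong τ τq) τp
      go (no x≢p) (no x≢q) = trans (cong τ (τ-else x≢p x≢q)) (τ-else x≢p x≢q)

    τ-right : ∀ {x y} → x ~ y → x ~ τ y
    τ-right {x} {y} e = go (y ≟ p) (y ≟ q)
      where
      go : Dec (y ≡ p) → Dec (y ≡ q) → x ~ τ y
      go (yes refl) _ = subst (x ~_) (≡sym τp) (~sym (p⊆q x (~sym e)))
      go (no _) (yes refl) = subst (x ~_) (≡sym τq) (~sym (q⊆p x (~sym e)))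
      go (no y≢p) (no y≢q) = subst (x ~_) (≡sym (τ-else y≢p y≢q)) e

    τ~ : ∀ {x y} → x ~ y → τ x ~ τ y
    τ~ e = ~sym (τ-right (~sym (τ-right e)))

    interchange : Aut G
    interchange = mk↔ₛ′ τ τ ττ ττ , λ x y → mk⇔ τ~ λ e → subst₂ _~_ (ττ x) (ττ y) (τ~ e)

  -- The root is recognised as a black vertex of valence 2 with black neighbours

  module Generic (a b : X) (nv : N2 v a b) (t1 : Type1 G v)
    (no-triangle : ¬ (a ~ b × (Val2 a ⊎ Val2 b))) where

    Sp : X → Set
    Sp x = ℓ x ≤ 1

    SameVal2 : X → X → Set
    SameVal2 x y = (Val2 x → Val2 y) × (Val2 y → Val2 x)

    -- Only twins that agree on `Val2` can be exchanged; in return, a black vertex of valence 2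
    -- beyond level 1 has a twin of valence 2.
    T : X → X → Set
    T x y = Tw x y × SameVal2 x y

    -- If two linked vertices were both black, a vertex of valence 2 other than v could be
    -- black with black neighbours.
    Horizontal Diamond : X → X → Set
    Horizontal x s = x ~ s × (Val2 x ⊎ Val2 s)
    Diamond x s = ∃₂ λ z z′ → z ≢ z′ × (Val2 z × Par z x × Par z s) × (Val2 z′ × Par z′ x × Par z′ s)

    L : X → X → Set
    L x s = 2 ≤ ℓ x × ℓ x ≡ ℓ s × x ≢ s × (Horizontal x s ⊎ Diamond x s)

    Diamond? : ∀ x s → Dec (Diamond x s)
    Diamond? x s = map′ (λ (z , _ , z′ , _ , r) → z , z′ , r)
      (λ (z , z′ , r@(_ , (_ , a , _) , (_ , a′ , _))) → z , ~sym (proj₁ a) , z′ , ~sym (proj₁ a′) , r)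
      (∃~? (λ z → ∃~? (λ z′ → ¬? (z ≟ z′) ×-dec tip z ×-dec tip z′) x) x)
      where
      tip : ∀ z → Dec (Val2 z × Par z x × Par z s)
      tip z = Val2? z ×-dec Par? z x ×-dec Par? z s

    Horizontal-sym : ∀ {x s} → Horizontal x s → Horizontal s x
    Horizontal-sym (e , w) = ~sym e , swap w

    Diamond-sym : ∀ {x s} → Diamond x s → Diamond s x
    Diamond-sym (z , z′ , ne , (w , a , b) , (w′ , a′ , b′)) = z , z′ , ne , (w , b , a) , (w′ , b′ , a′)

    L-sym : ∀ {x s} → L x s → L s x
    L-sym (l , eq , ne , h) = subst (2 ≤_) eq l , ≡sym eq , ne ∘ ≡sym , [ inj₁ ∘ Horizontal-sym , inj₂ ∘ Diamond-sym ]′ h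

    scheme : Scheme
    scheme = record
      { Sp = Sp ; Sp? = λ x → ℓ x ≤? 1
      ; T = T ; T? = λ x y → Tw? x y ×-dec (Val2? x →-dec Val2? y) ×-dec (Val2? y →-dec Val2? x)
      ; T⇒Tw = proj₁
      ; T-sym = λ (t , h , k) → Tw-sym t , k , h
      ; T⇒¬Sp = λ ((_ , 2≤ , _) , _) sp → <-irrefl refl (≤-trans 2≤ sp)
      ; L = L
      ; L? = λ x s → 2 ≤? ℓ x ×-dec ℓ x ℕ.≟ ℓ s ×-dec ¬? (x ≟ s)
          ×-dec ((x ~? s ×-dec (Val2? x ⊎-dec Val2? s)) ⊎-dec Diamond? x s)
      ; L-near = λ { {x} (_ , _ , _ , inj₁ (e , _)) → ∈-++⁺ˡ (nb⁺ e)
                   ; {x} (_ , _ , _ , inj₂ (_ , _ , _ , (_ , a , b) , _)) →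
                       ∈-++⁺ʳ (nb x) (near⁺ (~sym (proj₁ a)) (proj₁ b)) }
      ; L-ℓ = λ (_ , eq , _) → eq
      ; L-irr = λ (_ , _ , ne , _) → ne refl
      }
    open Scheme scheme using (Black; rigid; distinguishing)

    up : ∀ {x} → 2 ≤ ℓ x → ∃ (Par x)
    up 2≤ = parent (ℓ>0⇒≢v (<⇒≤ 2≤))

    diamond-no-horizontal : ∀ {x s t} → 2 ≤ ℓ x → Diamond x s → x ~ t → ℓ x ≡ ℓ t → ⊥
    diamond-no-horizontal 2≤ (z , z′ , ne , (_ , a , _) , (_ , a′ , _)) e eq =
      let p , b = up 2≤ in
      four (proj₁ b) e (~sym (proj₁ a)) (~sym (proj₁ a′))
        (ℓ<⇒≢ (subst (_ <_) eq (Par-< b)))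
        (ℓ<⇒≢ (<-trans (Par-< b) (Par-< a))) (ℓ<⇒≢ (<-trans (Par-< b) (Par-< a′)))
        (ℓ<⇒≢ (subst (_< _) eq (Par-< a))) (ℓ<⇒≢ (subst (_< _) eq (Par-< a′))) ne

    -- The children of `x` are the tips of the first diamond, so a tip of the second is one of them;
    -- its valence 2 leaves one neighbour besides `x`.
    diamond-unique : ∀ {x s t} → 2 ≤ ℓ x → x ≢ s → x ≢ t → Diamond x s → Diamond x t → s ≡ t
    diamond-unique {x} {s} {t} 2≤ x≢s x≢t
      (z , z′ , ne , ((_ , _ , n) , a , c) , ((_ , _ , n′) , a′ , c′)) (w , _ , _ , (_ , b , d) , _)
      with s ≟ t
    ... | yes eq = eq
    ... | no s≢t with up 2≤
    ... | p , u with only3 {x} (n3 (ℓ<⇒≢ (<-trans (Par-< u) (Par-< a))) (ℓ<⇒≢ (<-trans (Par-< u) (Par-< a′))) ne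
                      (proj₁ u) (~sym (proj₁ a)) (~sym (proj₁ a′))) w (~sym (proj₁ b))
    ... | inj₁ refl = ⊥-elim (Par-asym u b)
    ... | inj₂ (inj₁ refl) = ⊥-elim (N2-N3 n (n3 x≢s x≢t s≢t (proj₁ a) (proj₁ c) (proj₁ d)))
    ... | inj₂ (inj₂ refl) = ⊥-elim (N2-N3 n′ (n3 x≢s x≢t s≢t (proj₁ a′) (proj₁ c′) (proj₁ d)))

    -- A vertex linked by a diamond has no other link. If all links are horizontal, `x` and `s` each
    -- have a parent and two neighbours on their level, while one of them has valence 2.
    no-path : ∀ {x x′ s s′} → x ≢ x′ → s ≢ s′ → L x s → L x′ s → L x s′ → ⊥
    no-path xx ss (2≤ , eq , ne , inj₂ d) _ (_ , _ , ne′ , inj₂ d′) = ss (diamond-unique 2≤ ne ne′ d d′)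
    no-path xx ss (2≤ , eq , ne , inj₂ d) _ (_ , eq′ , _ , inj₁ (e , _)) = diamond-no-horizontal 2≤ d e eq′
    no-path xx ss (2≤ , eq , ne , inj₁ (e , _)) _ (_ , _ , _ , inj₂ d) = diamond-no-horizontal 2≤ d e eq
    no-path xx ss (2≤ , eq , _ , inj₁ (e , _)) (_ , _ , _ , inj₂ d) _ =
      diamond-no-horizontal (subst (2 ≤_) eq 2≤) (Diamond-sym d) (~sym e) (≡sym eq)
    no-path {x} {x′} {s} {s′} xx ss (2≤ , eq , _ , inj₁ (e , w)) (_ , eq′ , _ , inj₁ (e′ , _)) (_ , eq″ , _ , inj₁ (e″ , _))
      with up 2≤ | up (subst (2 ≤_) eq 2≤)
    ... | p , a | q , b = [ (λ (_ , _ , n) → N2-N3 n three-x) , (λ (_ , _ , n) → N2-N3 n three-s) ]′ w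
      where
      three-x : N3 x p s s′
      three-x = n3 (ℓ<⇒≢ (subst (_ <_) eq (Par-< a))) (ℓ<⇒≢ (subst (_ <_) eq″ (Par-< a))) ss (proj₁ a) e e″
      three-s : N3 s q x x′
      three-s = n3 (ℓ<⇒≢ (subst (_ <_) (≡sym eq) (Par-< b))) (ℓ<⇒≢ (subst (_ <_) (≡sym eq′) (Par-< b))) xx
        (proj₁ b) (~sym e) (~sym e′)

    -- Each of `x` and `s` tolerates the link because its twin shares it, or because it comes first
    -- and is not linked to the twin of the other. Sharing twice contradicts `no-path`, coming first
    -- twice is absurd, and the mixed cases contradict each other.
    not-both-black : ∀ {x s} → L x s → Black x → Black s → ⊥
    not-both-black (2≤ , _) (inj₁ sp) _ = <-irrefl refl (≤-trans 2≤ sp)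
    not-both-black (2≤ , eq , _) (inj₂ _) (inj₁ sp) = <-irrefl refl (≤-trans 2≤ (subst (_≤ 1) (≡sym eq) sp))
    not-both-black {x} {s} l (inj₂ (x′ , t , _ , see)) (inj₂ (s′ , u , _ , see′)) with see s l | see′ x (L-sym l)
    ... | inj₁ l′ | inj₁ l″ = no-path (proj₁ (proj₁ t)) (proj₁ (proj₁ u)) l l′ (L-sym l″)
    ... | inj₁ l′ | inj₂ (_ , none) = none x′ t (L-sym l′)
    ... | inj₂ (_ , none) | inj₁ l″ = none s′ u (L-sym l″)
    ... | inj₂ (lt , _) | inj₂ (gt , _) = <-asym lt gt

    BlackStar : X → Set
    BlackStar z = Val2 z × Black z × (∀ w → z ~ w → Black w)

    -- A twin of `u` would be a second child of `z`, whose only other neighbour `p` lies on a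
    -- different level.
    only-child-white : ∀ {z p u} → N2 z p u → Par u z → 2 ≤ ℓ u → (ℓ p ≢ ℓ u) → ¬ Black u
    only-child-white n a 2≤ ne (inj₁ sp) = <-irrefl refl (≤-trans 2≤ sp)
    only-child-white n a 2≤ ne (inj₂ (u′ , (t , _) , _)) with N2.only n u′ (~sym (proj₁ (Tw-par t a)))
    ... | inj₁ refl = ne (≡sym (proj₁ (proj₂ (proj₂ t))))
    ... | inj₂ refl = proj₁ t refl

    -- The second neighbour of `y` is an only child, hence white, or the other neighbour of `v`,
    -- which would close the excluded triangle.
    level1-star : ∀ {y y′} → N2 v y y′ → ¬ (y ~ y′ × Val2 y) → ¬ BlackStar y
    level1-star {y} {y′} n no-edge (val@(c , d , m) , _ , black) = go (N2.only m v (~sym (N2.~y n)))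
      where
      child : ∀ {u} → N2 y v u → ⊥
      child {u} m with compare (~sym (N2.~z m))
      ... | inj₁ a@(_ , eq) = only-child-white m a (≤-trans (s≤s (n≢0⇒n>0 λ z → ~≢ (N2.~y m) (ℓ≡0 z))) (Par-< a))
              (λ eq′ → <-irrefl (trans (≡sym ℓv) eq′) (≤-trans (s≤s z≤n) (Par-< a))) (black u (N2.~z m))
      ... | inj₂ le with ℓ≤1 {u} (≤-trans ([ ≤-reflexive , (λ a → <⇒≤ (Par-< a)) ]′ le) (ℓ-nb (N2.~y n)))
      ... | inj₁ refl = N2.y≢z m refl
      ... | inj₂ e = no-edge (subst (y ~_) (N2-other n e (λ { refl → ~≢ (N2.~z m) refl })) (N2.~z m) , val)
      go : v ≡ c ⊎ v ≡ d → ⊥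
      go (inj₁ refl) = child m
      go (inj₂ refl) = child (N2-swap m)

    -- Beyond level 1, let `u` be the neighbour of `z` other than a parent `p`. A second parent is
    -- linked to `p` by the diamond with tips `z` and its twin, unless both parents are on level 1;
    -- a neighbour on the same level is linked to `z`; a child is white.
    star-is-root : ∀ {z} → BlackStar z → z ≡ v
    star-is-root {z} star with ℓ z ≤? 1
    star-is-root {z} star | yes le with ℓ≤1 le
    ... | inj₁ eq = eq
    ... | inj₂ e with N2.only nv z e
    ... | inj₁ refl = ⊥-elim (level1-star nv (λ (e , w) → no-triangle (e , inj₁ w)) star)
    ... | inj₂ refl = ⊥-elim (level1-star (N2-swap nv) (λ (e , w) → no-triangle (~sym e , inj₂ w)) star)
    star-is-root {z} (_ , inj₁ sp , _) | no gt = contradiction sp gt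
    star-is-root {z} ((c , d , m) , bz@(inj₂ (z′ , (t , h , _) , _)) , black) | no gt with up (≰⇒> gt)
    ... | p , a = ⊥-elim (go (N2.only m p (proj₁ a)))
      where
      z≥2 : 2 ≤ ℓ z
      z≥2 = ≰⇒> gt
      both-parents : ∀ {u} → N2 z p u → Par z u → ⊥
      both-parents {u} m a′ with ℓ p ≤? 1
      ... | no p>1 = not-both-black {p} {u} (≰⇒> p>1 , suc-injective (trans (≡sym (proj₂ a)) (proj₂ a′)) , N2.y≢z m
              , inj₂ (z , z′ , proj₁ t , ((_ , _ , m) , a , a′) , (h (_ , _ , m) , Tw-par t a , Tw-par t a′)))
              (black p (proj₁ a)) (black u (proj₁ a′))
      ... | yes p≤1 with ℓ≤1 p≤1 | ℓ≤1 (subst (_≤ 1) (suc-injective (trans (≡sym (proj₂ a)) (proj₂ a′))) p≤1)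
      ... | inj₁ refl | _ = <-irrefl refl (≤-trans z≥2 (≤-reflexive (trans (proj₂ a) (cong suc ℓv))))
      ... | inj₂ _ | inj₁ refl = <-irrefl refl (≤-trans z≥2 (≤-reflexive (trans (proj₂ a′) (cong suc ℓv))))
      -- Both `p` and `u` are adjacent to `v` and have the neighbours `v`, `z`, `z′`; interchanging
      -- them fixes `v`, against type 1.
      ... | inj₂ vp | inj₂ vu = N2.y≢z m (trans (≡sym (t1 I.interchange τv p vp)) I.τp)
        where
        star-nb : ∀ {q} → v ~ q → Par z q → N3 q v z z′
        star-nb e a = n3 (ℓ>0⇒≢v (<⇒≤ z≥2) ∘ ≡sym) (ℓ>0⇒≢v (<⇒≤ (proj₁ (proj₂ (Tw-sym t)))) ∘ ≡sym) (proj₁ t)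
          (~sym e) (~sym (proj₁ a)) (~sym (proj₁ (Tw-par t a)))
        same : ∀ {q r} → v ~ q → v ~ r → Par z q → Par z r → ∀ w → q ~ w → r ~ w
        same eq er aq ar w e with only3 (star-nb eq aq) w e
        ... | inj₁ refl = ~sym er
        ... | inj₂ (inj₁ refl) = ~sym (proj₁ ar)
        ... | inj₂ (inj₂ refl) = ~sym (proj₁ (Tw-par t ar))
        module I = Interchange {p} {u} (same vp vu a a′) (same vu vp a′ a)
        τv : I.τ v ≡ v
        τv = I.τ-else (~≢ vp) (~≢ vu)
      other : ∀ {u} → N2 z p u → ⊥
      other {u} m with compare (N2.~z m)
      ... | inj₁ a′ = both-parents m a′
      ... | inj₂ (inj₁ eq) = not-both-black {z} {u} (z≥2 , eq , ~≢ (N2.~z m) , inj₁ (N2.~z m , inj₁ (_ , _ , m)))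
              bz (black u (N2.~z m))
      ... | inj₂ (inj₂ a′) = only-child-white m a′ (≤-trans z≥2 (<⇒≤ (Par-< a′)))
              (λ eq → <-irrefl eq (<-trans (Par-< a) (Par-< a′))) (black u (N2.~z m))
      go : p ≡ c ⊎ p ≡ d → ⊥
      go (inj₁ refl) = other m
      go (inj₂ refl) = other (N2-swap m)

    D≤2 : DistinguishingNumber≤2 G
    D≤2 = distinguishing λ A pres → let open Au A in
      let fv = star-is-root (Val2-f (_ , _ , nv) , pres (inj₁ (≤-trans (≤-reflexive ℓv) z≤n)) ,
            λ w e → subst Black (fg w) (pres (inj₁ (ℓ-nb (preimage e)))))
      in rigid A pres (L-f A fv)
        (λ x 2≤ below fx≢x → moved-Tw A fv x 2≤ below fx≢x , Val2-f ,
          λ w → subst Val2 (gf x) (Au.Val2-f (inv A) w))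
        (ball-fixed t1 A fv)
      where
      L-f : (A : Au) → let open Au A in f v ≡ v → ∀ {x s} → L x s → L (f x) (f s)
      L-f A fv {x} {s} (2≤ , eq , ne , h) = subst (2 ≤_) (≡sym (ℓ-f A fv x)) 2≤ ,
        trans (ℓ-f A fv x) (trans eq (≡sym (ℓ-f A fv s))) , ne ∘ f-inj , link h
        where
        open Au A
        link : Horizontal x s ⊎ Diamond x s → Horizontal (f x) (f s) ⊎ Diamond (f x) (f s)
        link (inj₁ (e , w)) = inj₁ (f~ e , [ inj₁ ∘ Val2-f , inj₂ ∘ Val2-f ]′ w)
        link (inj₂ (z , z′ , ne , (w , a , b) , (w′ , a′ , b′))) = inj₂ (f z , f z′ , ne ∘ f-inj ,
          (Val2-f w , Par-f A fv a , Par-f A fv b) , (Val2-f w′ , Par-f A fv a′ , Par-f A fv b′))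

  -- Br j x p says that cutting the edge xp leaves on the side of x a binary tree of depth
  -- j + 1 with root x whose leaves are joined to their siblings.

  Br : ℕ → X → X → Set
  Br zero x p = ∃₂ λ y z → N3 x p y z × N2 y x z × N2 z x y
  Br (suc j) x p = ∃₂ λ y z → N3 x p y z × Br j y x × Br j z x

  Br? : ∀ j x p → Dec (Br j x p)
  Br? zero x p = map′ (λ (y , _ , z , _ , r) → y , z , r) (λ (y , z , r@(n , _)) → y , N3.~y n , z , N3.~z n , r)
    (∃~? (λ y → ∃~? (λ z → N3? x p y z ×-dec N2? y x z ×-dec N2? z x y) x) x)
  Br? (suc j) x p = map′ (λ (y , _ , z , _ , r) → y , z , r) (λ (y , z , r@(n , _)) → y , N3.~y n , z , N3.~z n , r)
    (∃~? (λ y → ∃~? (λ z → N3? x p y z ×-dec Br? j y x ×-dec Br? j z x) x) x)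

  Br-f : (A : Au) → let open Au A in ∀ j {x p} → Br j x p → Br j (f x) (f p)
  Br-f A zero (y , z , n , m , m′) = let open Au A in f y , f z , N3-f n , N2-f m , N2-f m′
  Br-f A (suc j) (y , z , n , m , m′) = let open Au A in f y , f z , N3-f n , Br-f A j m , Br-f A j m′

  -- Heights are shifted by one against `Br`, so that a leaf joined to its sibling has height 0 and
  -- all children are treated alike.
  BrChild : ℕ → X → X → Set
  BrChild zero y x = ∃ λ z → N2 y x z × N2 z x y
  BrChild (suc j) y x = Br j y x

  Br-children : ∀ j {x p} → Br j x p → ∃₂ λ y z → N3 x p y z × BrChild j y x × BrChild j z x
  Br-children zero (y , z , n , m , m′) = y , z , n , (z , m , m′) , (y , m′ , m)
  Br-children (suc j) b = b

  Br-¬Val2 : ∀ j {x p} → Br j x p → ¬ Val2 x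
  Br-¬Val2 j b (_ , _ , n) = let _ , _ , m , _ = Br-children j b in N2-N3 n m

  Br~ : ∀ j {x p} → Br j x p → x ~ p
  Br~ j b = let _ , _ , n , _ = Br-children j b in N3.~p n

  Br-other : ∀ j {x p w} → Br j x p → x ~ w → w ≢ p → BrChild j w x
  Br-other j b e w≢p with Br-children j b
  ... | y , z , n , m , m′ with only3 n _ e
  ... | inj₁ eq = contradiction eq w≢p
  ... | inj₂ (inj₁ refl) = m
  ... | inj₂ (inj₂ refl) = m′

  -- At most one child in the first branch is the attaching vertex `q` of the second, so the
  -- branches share a child; at the bottom, leaves are told apart by their valence 2.
  Br-height : ∀ i j {x p q} → Br i x p → Br j x q → i ≡ j
  BrChild-height : ∀ i j {w x y} → BrChild i w x → BrChild j w y → i ≡ j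
  Br-height i j {x} {p} {q} b b′ with Br-children i b
  ... | y , z , n , m , m′ with y ≟ q
  ... | no y≢q = BrChild-height i j m (Br-other j b′ (N3.~y n) y≢q)
  ... | yes refl = BrChild-height i j m′ (Br-other j b′ (N3.~z n) (N3.y≢z n ∘ ≡sym))
  BrChild-height zero zero _ _ = refl
  BrChild-height zero (suc j) (_ , m , _) b = contradiction (_ , _ , m) (Br-¬Val2 j b)
  BrChild-height (suc i) zero b (_ , m , _) = contradiction (_ , _ , m) (Br-¬Val2 i b)
  BrChild-height (suc i) (suc j) b b′ = cong suc (Br-height i j b b′)

  -- A vertex with three branches of equal height: isomorphism with `S n`

  module Exceptional (c : X) (h : ℕ) (y : Fin 3 → X) (c~y : ∀ i → c ~ y i)
    (y-injective : ∀ i j → y i ≡ y j → i ≡ j) (y-only : ∀ w → c ~ w → ∃ λ i → y i ≡ w)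
    (y-Br : ∀ i → Br h (y i) c) where

    -- The root of a branch is one step from `c`, and its leaves are `h + 1` steps further.
    n : ℕ
    n = suc (suc h)

    record Spot : Set where
      constructor spot
      field
        height   : ℕ
        at above : X
        branch   : BrChild height at above
    open Spot

    child : ∀ (β : Bool) k {x q} → BrChild (suc k) x q → Σ X λ w → BrChild k w x
    child false k b = let y , _ , _ , m , _ = Br-children k b in y , m
    child true k b = let _ , z , _ , _ , m = Br-children k b in z , m

    -- Descending from a leaf stays at the leaf.
    down : Bool → Spot → Spot
    down β (spot zero x q b) = spot zero x q b
    down β (spot (suc k) x q b) = let w , m = child β k b in spot k w x m

    spot-of : Fin 3 → List Bool → Spot
    spot-of i [] = spot (suc h) (y i) c (y-Br i)
    spot-of i (β ∷ p) = down β (spot-of i p)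

    φ : TVtx n → X
    φ root = c
    φ (node i p _) = at (spot-of i p)

    down-height : ∀ β s → height (down β s) ≡ ℕ.pred (height s)
    down-height β (spot zero _ _ _) = refl
    down-height β (spot (suc _) _ _ _) = refl

    spot-height : ∀ i p → height (spot-of i p) ≡ suc h ∸ length p
    spot-height i [] = refl
    spot-height i (β ∷ p) = trans (down-height β (spot-of i p))
      (trans (cong ℕ.pred (spot-height i p)) (pred[m∸n]≡m∸[1+n] (suc h) (length p)))

    inner : ∀ i p → length p ≤ h → ∃ λ k → height (spot-of i p) ≡ suc k
    inner i p le = h ∸ length p , trans (spot-height i p) (+-∸-assoc 1 le)

    down-above : ∀ β s {k} → height s ≡ suc k → above (down β s) ≡ at s
    down-above β (spot (suc _) _ _ _) _ = refl

    down-N3 : ∀ s {k} → height s ≡ suc k → N3 (at s) (above s) (at (down false s)) (at (down true s))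
    down-N3 (spot (suc k) _ _ b) _ = let _ , _ , m , _ = Br-children k b in m

    down-~ : ∀ β s {k} → height s ≡ suc k → at s ~ at (down β s)
    down-~ false s eq = N3.~y (down-N3 s eq)
    down-~ true s eq = N3.~z (down-N3 s eq)

    down-injective : ∀ β γ s {k} → height s ≡ suc k → at (down β s) ≡ at (down γ s) → β ≡ γ
    down-injective false false s _ _ = refl
    down-injective true true s _ _ = refl
    down-injective false true s eq e = contradiction e (N3.y≢z (down-N3 s eq))
    down-injective true false s eq e = contradiction (≡sym e) (N3.y≢z (down-N3 s eq))

    leaf-N2 : ∀ β s → height s ≡ 1 → N2 (at (down β s)) (at s) (at (down (not β) s))
    leaf-N2 false (spot (suc zero) _ _ (_ , _ , _ , m , _)) _ = m
    leaf-N2 true (spot (suc zero) _ _ (_ , _ , _ , _ , m)) _ = m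

    -- The neighbours of `x` other than `u` are its children or its sibling leaf, whose heights are
    -- smaller than that of `u′`.
    above-unique : ∀ k {x u u′ q q′} → BrChild k x u → BrChild k x u′ →
      BrChild (suc k) u q → BrChild (suc k) u′ q′ → u ≡ u′
    above-unique k {u = u} {u′} b b′ top top′ with u′ ≟ u
    ... | yes eq = ≡sym eq
    above-unique zero (z , m , m′) (_ , l , _) top top′ | no ne with N2-other m (N2.~y l) ne
    ... | refl = ⊥-elim (Br-¬Val2 0 top′ (_ , _ , m′))
    above-unique (suc k) b b′ top top′ | no ne =
      ⊥-elim (<-irrefl (BrChild-height k (suc (suc k)) (Br-other k b (Br~ k b′) ne) top′) (m≤n⇒m≤1+n (n<1+n k)))

    down-above-unique : ∀ β γ s t {k l} → height s ≡ suc k → height t ≡ suc l →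
      at (down β s) ≡ at (down γ t) → at s ≡ at t
    down-above-unique β γ (spot (suc k) x q b) (spot (suc l) x′ q′ b′) refl refl eq
      with child β k b | child γ l b′
    ... | w , m | w′ , m′ with eq
    ... | refl with BrChild-height k l m m′
    ... | refl = above-unique k m m′ b b′

    same-length : ∀ i j p q → length p ≤ suc h → length q ≤ suc h →
      at (spot-of i p) ≡ at (spot-of j q) → length p ≡ length q
    same-length i j p q p≤ q≤ eq = ∸-cancelˡ-≡ p≤ q≤
      (trans (≡sym (spot-height i p)) (trans heights (spot-height j q)))
      where
      heights : height (spot-of i p) ≡ height (spot-of j q)
      heights = BrChild-height _ _ (branch (spot-of i p))
        (subst (λ x → BrChild (height (spot-of j q)) x (above (spot-of j q))) (≡sym eq) (branch (spot-of j q)))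

    at-injective : ∀ i j p q → length p ≡ length q → length p ≤ suc h →
      at (spot-of i p) ≡ at (spot-of j q) → i ≡ j × p ≡ q
    at-injective i j [] [] _ _ eq = y-injective i j eq , refl
    at-injective i j (β ∷ p) (γ ∷ q) len (s≤s le) eq
      with inner i p le | inner j q (subst (_≤ h) (suc-injective len) le)
    ... | _ , hp | _ , hq
      with at-injective i j p q (suc-injective len) (m≤n⇒m≤1+n le)
             (down-above-unique β γ (spot-of i p) (spot-of j q) hp hq eq)
    ... | refl , refl = refl , cong (_∷ p) (down-injective β γ (spot-of i p) hp eq)

    -- The `y i` have height `h + 1`, so `c` would be higher than every spot; hence only `root` is
    -- sent to `c`.
    c-height : ∀ k {q} → BrChild k c q → k ≡ suc (suc h)
    c-height zero (_ , m , _) = ⊥-elim (N2-N3 m (n3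
      (λ e → contradiction (y-injective _ _ e) λ ()) (λ e → contradiction (y-injective _ _ e) λ ())
      (λ e → contradiction (y-injective _ _ e) λ ())
      (c~y Fin.zero) (c~y (Fin.suc Fin.zero)) (c~y (Fin.suc (Fin.suc Fin.zero)))))
    c-height (suc k) b with Br-children k b
    ... | w , _ , m , bw , _ with y-only w (N3.~y m)
    ... | i , refl = cong suc (BrChild-height k (suc h) bw (y-Br i))

    at≢c : ∀ i p → at (spot-of i p) ≢ c
    at≢c i p eq = <-irrefl (c-height (height (spot-of i p)) {above (spot-of i p)}
      (subst (λ x → BrChild (height (spot-of i p)) x (above (spot-of i p))) eq (branch (spot-of i p))))
      (s≤s (≤-trans (≤-reflexive (spot-height i p)) (m∸n≤m (suc h) (length p))))

    bound : (p : List Bool) → .(length p < n) → length p ≤ suc h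
    bound p lt = ≤-pred (recompute (length p <? n) lt)

    φ-injective : ∀ s t → φ s ≡ φ t → s ≡ t
    φ-injective root root _ = refl
    φ-injective root (node i p _) eq = contradiction (≡sym eq) (at≢c i p)
    φ-injective (node i p _) root eq = contradiction eq (at≢c i p)
    φ-injective (node i p lt) (node j q lt′) eq
      with at-injective i j p q (same-length i j p q (bound p lt) (bound q lt′) eq) (bound p lt) eq
    ... | refl , refl = refl

    SEdge⇒~ : ∀ {s t} → SEdge n s t → φ s ~ φ t
    SEdge⇒~ (rootEdge i _) = c~y i
    SEdge⇒~ (childEdge i p β lt lt′) = down-~ β (spot-of i p) (proj₂ (inner i p (≤-pred (bound (β ∷ p) lt′))))
    SEdge⇒~ (leafEdge i p _ _ eq) = N2.~z (leaf-N2 false (spot-of i p)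
      (trans (spot-height i p) (trans (cong (suc h ∸_) (suc-injective (suc-injective eq))) (m+n∸n≡m 1 h))))

    SAdj⇒~ : ∀ {s t} → SAdj n s t → φ s ~ φ t
    SAdj⇒~ (inj₁ e) = SEdge⇒~ e
    SAdj⇒~ (inj₂ e) = ~sym (SEdge⇒~ e)

    -- Serves twice: walks from `c` turn it into surjectivity, and injectivity of `φ` turns it into
    -- reflection of adjacency.
    ~⇒SAdj : ∀ s z → φ s ~ z → ∃ λ t → SAdj n s t × φ t ≡ z
    ~⇒SAdj root z e = let i , eq = y-only z e in node i [] (s≤s z≤n) , inj₁ (rootEdge i (s≤s z≤n)) , eq
    ~⇒SAdj (node i p lt) z e = go (length p ≤? h)
      where
      s = spot-of i p
      Neighbour : X → Set
      Neighbour z = ∃ λ t → SAdj n (node i p lt) t × φ t ≡ z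
      upward : ∀ p .(lt : length p < n) → ∃ λ t → SAdj n (node i p lt) t × φ t ≡ above (spot-of i p)
      upward [] lt = root , inj₂ (rootEdge i _) , refl
      upward (β ∷ p) lt = node i p (<-trans (n<1+n _) lt) , inj₂ (childEdge i p β _ lt) ,
        ≡sym (down-above β (spot-of i p) (proj₂ (inner i p (≤-pred (bound (β ∷ p) lt)))))
      downward : ∀ β → length p ≤ h → Neighbour (at (down β s))
      downward β le = node i (β ∷ p) (s≤s (s≤s le)) , inj₁ (childEdge i p β lt _) , refl
      leaf : ∀ p .(lt : length p < n) → ¬ length p ≤ h → at (spot-of i p) ~ z →
        ∃ λ t → SAdj n (node i p lt) t × φ t ≡ z
      leaf [] lt deep e = contradiction z≤n deep
      leaf (β ∷ p) lt deep e = go′ (N2.only (leaf-N2 β (spot-of i p) one) z e)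
        where
        len : length p ≡ h
        len = ≤-antisym (≤-pred (bound (β ∷ p) lt)) (≤-pred (≰⇒> deep))
        one : height (spot-of i p) ≡ 1
        one = trans (spot-height i p) (trans (cong (suc h ∸_) len) (m+n∸n≡m 1 h))
        edge : ∀ β .(lt : suc (length p) < n) .(lt′ : suc (length p) < n) → SAdj n (node i (β ∷ p) lt) (node i (not β ∷ p) lt′)
        edge false lt lt′ = inj₁ (leafEdge i p lt lt′ (cong (λ l → suc (suc l)) len))
        edge true lt lt′ = inj₂ (leafEdge i p lt′ lt (cong (λ l → suc (suc l)) len))
        go′ : z ≡ at (spot-of i p) ⊎ z ≡ at (down (not β) (spot-of i p)) →
          ∃ λ t → SAdj n (node i (β ∷ p) lt) t × φ t ≡ z
        go′ (inj₁ eq) = node i p (<-trans (n<1+n _) lt) , inj₂ (childEdge i p β _ lt) , ≡sym eq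
        go′ (inj₂ eq) = node i (not β ∷ p) lt , edge β lt lt , ≡sym eq
      go : Dec (length p ≤ h) → Neighbour z
      go (no deep) = leaf p lt deep e
      go (yes le) with only3 (down-N3 s (proj₂ (inner i p le))) z e
      ... | inj₁ refl = upward p lt
      ... | inj₂ (inj₁ refl) = downward false le
      ... | inj₂ (inj₂ refl) = downward true le

    φ-surjective : ∀ s z → Walk G (φ s) z → ∃ λ t → φ t ≡ z
    φ-surjective s z Walk.here = s , refl
    φ-surjective s z (step {y = y} e w) with ~⇒SAdj s y e
    ... | t , _ , refl = φ-surjective t z w

    ψ : X → TVtx n
    ψ z = proj₁ (φ-surjective root z (conn c z))

    φψ : ∀ z → φ (ψ z) ≡ z
    φψ z = proj₂ (φ-surjective root z (conn c z))

    isomorphic : G ≅ S n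
    isomorphic = mk↔ₛ′ ψ φ (λ t → φ-injective _ _ (φψ (φ t))) φψ , λ x y → mk⇔
      (λ e → let t , adj , eq = ~⇒SAdj (ψ x) y (subst (_~ y) (≡sym (φψ x)) e)
             in subst (SAdj n (ψ x)) (φ-injective _ _ (trans eq (≡sym (φψ y)))) adj)
      (λ adj → subst₂ _~_ (φψ x) (φψ y) (SAdj⇒~ adj))

  -- The ray climbing from a triangle at the root

  module Triangle (a b c : X) (nv : N2 v a b) (na : N2 a v b) (n-b : N3 b v a c) (t1 : Type1 G v) where

    next : ℕ → X → X → X
    next j p x with ∃~? (λ w → ¬? (w ≟ p) ×-dec ¬? (Br? j w x)) x
    ... | yes (w , _) = w
    -- A default value, recognisable because `x` is not adjacent to itself.
    ... | no _ = x

    next-spec : ∀ j p x → x ~ next j p x → next j p x ≢ p × ¬ Br j (next j p x) x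
    next-spec j p x e with ∃~? (λ w → ¬? (w ≟ p) ×-dec ¬? (Br? j w x)) x
    ... | yes (_ , _ , h) = h
    ... | no _ = contradiction refl (~≢ e)

    next-unique : ∀ j p x {w} → x ~ w → w ≢ p → ¬ Br j w x →
      (∀ u → x ~ u → u ≢ p → ¬ Br j u x → u ≡ w) → next j p x ≡ w
    next-unique j p x e w≢p ¬b only with ∃~? (λ w → ¬? (w ≟ p) ×-dec ¬? (Br? j w x)) x
    ... | yes (u , e′ , u≢p , ¬b′) = only u e′ u≢p ¬b′
    ... | no none = contradiction (_ , e , w≢p , ¬b) none

    -- The way up from the triangle as long as every vertex met carries a second branch of the
    -- same height; where this fails, the remaining values are junk.
    r : ℕ → X
    r zero = b
    r (suc zero) = c
    r (suc (suc j)) = next j (r j) (r (suc j))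

    good : ℕ → Set
    good j = Br j (r j) (r (suc j))

    good₀ : good 0
    good₀ = v , a , n3 (N3.p≢z n-b ∘ ≡sym) (N3.y≢z n-b ∘ ≡sym) (N3.p≢y n-b) (N3.~z n-b) (N3.~p n-b) (N3.~y n-b)
      , N2-swap nv , N2-swap na

    Good : ℕ → Set
    Good j = ∀ i → i ≤ j → good i

    Good-pred : ∀ {j} → Good (suc j) → Good j
    Good-pred g i le = g i (m≤n⇒m≤1+n le)

    -- The branch in `good (suc j)` makes `r (suc (suc j))` a genuine neighbour, so `next-spec`
    -- applies; one of its two children is `r j`, the other is the side branch.
    climb : ∀ j → good j → good (suc j) → ∃ λ y →
      N3 (r (suc j)) (r (suc (suc j))) (r j) y × Br j y (r (suc j)) × ¬ Br j (r (suc (suc j))) (r (suc j))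
    climb j g g′@(y , z , n , m , m′) with next-spec j (r j) (r (suc j)) (Br~ (suc j) g′)
    ... | ne , ¬b with only3 n (r j) (~sym (Br~ j g))
    ... | inj₁ eq = contradiction (≡sym eq) ne
    ... | inj₂ (inj₁ refl) = z , n , m′ , ¬b
    ... | inj₂ (inj₂ refl) = y , N3-swap n , m , ¬b

    root-nb : ∀ {x y p} → N2 v x y → N3 x p v y → x ≡ b × p ≡ c
    root-nb {x} {y} {p} n m with N2.only nv x (N2.~y n)
    ... | inj₁ refl = ⊥-elim (N2-N3 na m)
    ... | inj₂ refl with N2-other (N2-swap nv) (N2.~z n) (N2.y≢z n ∘ ≡sym) | only3 n-b p (N3.~p m)
    ... | refl | inj₁ eq = contradiction eq (N3.p≢y m)
    ... | refl | inj₂ (inj₁ eq) = contradiction eq (N3.p≢z m)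
    ... | refl | inj₂ (inj₂ eq) = refl , eq

    -- The tips have no neighbours outside the triangle, so a chain of parents through `y` cannot
    -- leave it: one of the tips is `v`.
    triangle-parent : ∀ {x p y z} → N3 x p y z → N2 y x z → N2 z x y → Par x y → x ≡ b × p ≡ c
    triangle-parent {x} {p} {y} {z} n m m′ a with y ≟ v
    ... | yes refl = root-nb m n
    ... | no y≢v with parent y≢v
    ... | t , a′ with N2.only m t (proj₁ a′)
    ... | inj₁ refl = ⊥-elim (Par-asym a a′)
    ... | inj₂ refl with z ≟ v
    ... | yes refl = root-nb m′ (N3-swap n)
    ... | no z≢v with parent z≢v
    ... | t , a″ with N2.only m′ t (proj₁ a″)
    ... | inj₁ refl = ⊥-elim (<-asym (<-trans (Par-< a″) (Par-< a′)) (Par-< a))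
    ... | inj₂ refl = ⊥-elim (Par-asym a′ a″)

    -- The only branches whose attaching vertex is not the parent of their root are those containing v.
    Br-parent : ∀ j → Good j → ∀ {x p u} → Br j x p → Par x u → u ≡ p ⊎ (x ≡ r j × p ≡ r (suc j))
    Br-parent zero g {u = u} (y , z , n , m , m′) a with only3 n u (proj₁ a)
    ... | inj₁ eq = inj₁ eq
    ... | inj₂ (inj₁ refl) = inj₂ (triangle-parent n m m′ a)
    ... | inj₂ (inj₂ refl) = inj₂ (triangle-parent (N3-swap n) m′ m a)
    Br-parent (suc j) g {x} {p} {u} br a with u ≟ p
    ... | yes eq = inj₁ eq
    ... | no u≢p with Br-other (suc j) br (proj₁ a) u≢p
    ... | bu with parent {u} (λ { refl → Br-¬Val2 j bu (_ , _ , nv) })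
    ... | t , a′ with Br-parent j (Good-pred g) bu a′
    ... | inj₁ refl = ⊥-elim (Par-asym a a′)
    -- Now `x` is `r (suc j)`. Were `p` not the next ray vertex, that vertex would be a child of `x`
    -- in the branch, which `climb` excludes.
    ... | inj₂ (refl , refl) with climb j (g j (n≤1+n j)) (g (suc j) ≤-refl) | r (suc (suc j)) ≟ p
    ... | _ | yes eq = inj₂ (refl , ≡sym eq)
    ... | _ , m , _ , ¬b | no ne = ⊥-elim (¬b (Br-other (suc j) br (N3.~p m) ne))

    -- The colouring along a ray with index set `In`

    module Coloured (In : ℕ → Set) (In-down : ∀ {i j} → i ≤ j → In j → In i)
      (In-good : ∀ {i} → In i → good i) (h : ℕ)
      (Ray? : ∀ x → Dec (∃ λ i → In i × x ≡ r i))
      (Ray⁺? : ∀ x → Dec (∃ λ i → In i × (x ≡ r i ⊎ x ≡ r (suc i)))) where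

      In-Good : ∀ {j} → In j → Good j
      In-Good k i le = In-good (In-down le k)

      -- The vertex above the top of the ray lies in Ray⁺ only: it must not be black, or an
      -- automorphism could exchange it with the top when it carries a branch itself.
      Ray Ray⁺ : X → Set
      Ray x = ∃ λ i → In i × x ≡ r i
      Ray⁺ x = ∃ λ i → In i × (x ≡ r i ⊎ x ≡ r (suc i))

      SameBr : X → X → X → Set
      SameBr x y p = (Br h x p → Br h y p) × (Br h y p → Br h x p)

      -- Vertices of `Ray⁺` are fixed along with `v`, so colours need not separate them from twins;
      -- agreement on `Br h` serves at the top of a finite ray.
      T : X → X → Set
      T x y = Tw x y × ¬ Ray⁺ x × ¬ Ray⁺ y × (∀ p → Par x p → SameBr x y p)

      scheme : Scheme
      scheme = record
        { Sp = λ x → x ≡ v ⊎ Ray x ; Sp? = λ x → (x ≟ v) ⊎-dec Ray? x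
        ; T = T
        ; T? = λ x y → Tw? x y ×-dec ¬? (Ray⁺? x) ×-dec ¬? (Ray⁺? y) ×-dec
            ∀Par? (λ p → (Br? h x p →-dec Br? h y p) ×-dec (Br? h y p →-dec Br? h x p)) x
        ; T⇒Tw = proj₁
        ; T-sym = λ (t , x∉ , y∉ , s) → Tw-sym t , y∉ , x∉ ,
            λ p a → proj₂ (s p (Tw-par (Tw-sym t) a)) , proj₁ (s p (Tw-par (Tw-sym t) a))
        ; T⇒¬Sp = λ { (t , _) (inj₁ x≡v) → ℓ>0⇒≢v (<⇒≤ (proj₁ (proj₂ t))) x≡v
                    ; (_ , x∉ , _) (inj₂ (i , k , eq)) → x∉ (i , k , inj₁ eq) }
        ; L = λ _ _ → ⊥
        ; L? = λ _ _ → no λ ()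
        ; L-near = λ ()
        ; L-ℓ = λ ()
        ; L-irr = λ ()
        }
      open Scheme scheme using (Black; rigid; distinguishing)

      ¬Ray-Br : ∀ {i y q} → Br i y q → y ≢ r i → ¬ Ray y
      ¬Ray-Br {i} b y≢ (k , In-k , refl) with Br-height i k b (In-good In-k)
      ... | refl = y≢ refl

      Br-≢v : ∀ {i y q} → Br i y q → y ≢ v
      Br-≢v {i} b refl = Br-¬Val2 i b (_ , _ , nv)

      -- Its twins all lie on the ray, so the second branch at a ray vertex is white.
      side-white : ∀ {i y} → In i → Br i y (r (suc i)) → y ≢ r i →
        (∀ w → r (suc i) ~ w → w ≢ y → Ray⁺ w) → ¬ Black y
      side-white {i} k b y≢ others (inj₁ (inj₁ y≡v)) = Br-≢v {i} b y≡v
      side-white {i} k b y≢ others (inj₁ (inj₂ ray)) = ¬Ray-Br {i} b y≢ ray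
      side-white {i} k b y≢ others (inj₂ (z , (t , _ , z∉ , _) , _)) with parent (Br-≢v {i} b)
      ... | u , a with Br-parent i (In-Good k) b a
      ... | inj₂ (eq , _) = y≢ eq
      ... | inj₁ refl = z∉ (others z (~sym (proj₁ (Tw-par t a))) (proj₁ t ∘ ≡sym))

      a-white : ¬ Black a
      a-white (inj₁ (inj₁ a≡v)) = ~≢ (N2.~y na) a≡v
      a-white (inj₁ (inj₂ (i , k , eq))) = Br-¬Val2 i (In-good k) (subst Val2 eq (_ , _ , na))
      a-white (inj₂ (_ , (t , _) , _)) = <-irrefl refl (≤-trans (proj₁ (proj₂ t)) (ℓ-nb (N2.~y nv)))

      module _ (A : Au) (pres : ∀ {x} → Black x → Black (Au.f A x)) where
        open Au A

        -- The vertex `a` is white, so `v` cannot go there. If `v` went to `c`, then `a` would go to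
        -- `v` or `a`, neither of which is adjacent to `c`.
        v-fixed : f b ≡ b → f v ≡ v
        v-fixed fb with only3 n-b (f v) (subst (_~ f v) fb (f~ (N3.~p n-b)))
        ... | inj₁ eq = eq
        ... | inj₂ (inj₁ eq) = contradiction (subst Black eq (pres (inj₁ (inj₁ refl)))) a-white
        ... | inj₂ (inj₂ eq) with only3 n-b (f a) (subst (_~ f a) fb (f~ (N3.~y n-b)))
        ... | inj₁ fa = ⊥-elim (c-far (subst₂ _~_ fa eq (f~ (N2.~y na))))
          where
          c-far : ¬ v ~ c
          c-far e with N2.only nv c e
          ... | inj₁ c≡a = N3.y≢z n-b (≡sym c≡a)
          ... | inj₂ c≡b = ~≢ (N3.~z n-b) (≡sym c≡b)
        ... | inj₂ (inj₁ fa) = ⊥-elim (c-far (subst₂ _~_ fa eq (f~ (N2.~y na))))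
          where
          c-far : ¬ a ~ c
          c-far e with N2.only na c e
          ... | inj₁ c≡v = N3.p≢z n-b (≡sym c≡v)
          ... | inj₂ c≡b = ~≢ (N3.~z n-b) (≡sym c≡b)
        ... | inj₂ (inj₂ fa) = contradiction (f-inj (trans eq (≡sym fa))) (~≢ (N2.~y nv))

        -- Among the neighbours of `r (suc i)`, the outer one carries no branch of height `i` and
        -- the side branch is white, so `r i` is fixed too.
        descend : ∀ i → In i → f (r i) ≡ r i → f v ≡ v
        descend zero k fr = v-fixed fr
        descend (suc i) k fr with climb i (In-good (In-down (n≤1+n i) k)) (In-good k)
        ... | y , n , b , ¬b = descend i k′ (go (only3 n (f (r i)) (subst (_~ f (r i)) fr (f~ (N3.~y n)))))
          where
          k′ : In i
          k′ = In-down (n≤1+n i) k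
          on-ray : ∀ w → r (suc i) ~ w → w ≢ y → Ray⁺ w
          on-ray w e w≢y with only3 n w e
          ... | inj₁ eq = suc i , k , inj₂ eq
          ... | inj₂ (inj₁ eq) = i , k′ , inj₁ eq
          ... | inj₂ (inj₂ eq) = contradiction eq w≢y
          go : f (r i) ≡ r (suc (suc i)) ⊎ f (r i) ≡ r i ⊎ f (r i) ≡ y → f (r i) ≡ r i
          go (inj₁ eq) = ⊥-elim (¬b (subst₂ (Br i) eq fr (Br-f A i (In-good k′))))
          go (inj₂ (inj₁ eq)) = eq
          go (inj₂ (inj₂ eq)) = ⊥-elim (side-white k′ b (N3.y≢z n ∘ ≡sym) on-ray
            (subst Black eq (pres (inj₁ (inj₂ (i , k′ , refl))))))

        -- If the parent were not the attaching vertex, `Br-parent` would make `f` fix `r i`, and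
        -- `descend` would fix `v`.
        rise : f v ≢ v → ∀ {i} → In i → Par (f (r i)) (f (r (suc i)))
        rise fv≢v {i} k with parent (Br-≢v {i} (Br-f A i (In-good k)))
        ... | u , a with Br-parent i (In-Good k) (Br-f A i (In-good k)) a
        ... | inj₁ refl = a
        ... | inj₂ (eq , _) = contradiction (descend i k eq) fv≢v

        -- Type 1 fixes `a` and `b`, hence `c`. Further up, the outer neighbour cannot go to the
        -- side branch, as it carries no branch of that height.
        ray-fixed : f v ≡ v → ∀ i → In i → f (r i) ≡ r i × f (r (suc i)) ≡ r (suc i)
        ray-fixed fv zero k = fb , fc
          where
          fb : f b ≡ b
          fb = ball-fixed t1 A fv b (ℓ-nb (N2.~z nv))
          fc : f c ≡ c
          fc with only3 n-b (f c) (subst (_~ f c) fb (f~ (N3.~z n-b)))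
          ... | inj₁ eq = contradiction (f-inj (trans fv (≡sym eq))) (N3.p≢z n-b)
          ... | inj₂ (inj₁ eq) = contradiction (f-inj (trans (ball-fixed t1 A fv a (ℓ-nb (N2.~y nv))) (≡sym eq))) (N3.y≢z n-b)
          ... | inj₂ (inj₂ eq) = eq
        ray-fixed fv (suc i) k with ray-fixed fv i (In-down (n≤1+n i) k) | climb i (In-good (In-down (n≤1+n i) k)) (In-good k)
        ... | fr , fr′ | y , n , b , ¬b = fr′ , go (only3 n (f w) (subst (_~ f w) fr′ (f~ (N3.~p n))))
          where
          w = r (suc (suc i))
          go : f w ≡ w ⊎ f w ≡ r i ⊎ f w ≡ y → f w ≡ w
          go (inj₁ eq) = eq
          go (inj₂ (inj₁ eq)) = contradiction (f-inj (trans eq (≡sym fr))) (N3.p≢y n)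
          go (inj₂ (inj₂ eq)) = ⊥-elim (¬b (subst₂ (Br i) (trans (cong g (≡sym eq)) (gf w))
            (trans (cong g (≡sym fr′)) (gf (r (suc i)))) (Br-f (inv A) i b)))

        all-fixed : f v ≡ v → ∀ x → f x ≡ x
        all-fixed fv = rigid A pres (λ ()) twin (ball-fixed t1 A fv)
          where
          Ray⁺-fixed : ∀ {x} → Ray⁺ x → f x ≡ x
          Ray⁺-fixed (i , k , inj₁ refl) = proj₁ (ray-fixed fv i k)
          Ray⁺-fixed (i , k , inj₂ refl) = proj₂ (ray-fixed fv i k)
          twin : ∀ x → 2 ≤ ℓ x → (∀ y → ℓ y < ℓ x → f y ≡ y) → f x ≢ x → T x (f x)
          twin x 2≤ below ne = moved-Tw A fv x 2≤ below ne , ne ∘ Ray⁺-fixed , ne ∘ f-inj ∘ Ray⁺-fixed ,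
            λ p a → (λ b → subst (Br h (f x)) (below p (Par-< a)) (Br-f A h b)) ,
              λ b → subst₂ (Br h) (gf x) (trans (cong g (≡sym (below p (Par-< a)))) (gf p)) (Br-f (inv A) h b)

      D≤2 : (∀ A → (∀ {x} → Black x → Black (Au.f A x)) → Au.f A v ≢ v → ⊥) → DistinguishingNumber≤2 G
      D≤2 found = distinguishing λ A pres →
        all-fixed A pres (decidable-stable (Au.f A v ≟ v) (found A pres))

    -- An infinite ray

    module Infinite (all : ∀ i → good i) where

      -- If the parent were the next ray vertex, induction on the level would make `r (suc i)` the
      -- parent of that vertex. The side branch has `r (suc i)` as its own parent.
      ray-parent : ∀ i → Par (r (suc i)) (r i)
      ray-parent i = <-rec (λ n → ∀ i → ℓ (r (suc i)) ≡ n → Par (r (suc i)) (r i)) go _ i refl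
        where
        go : ∀ n → (∀ {m} → m < n → ∀ i → ℓ (r (suc i)) ≡ m → Par (r (suc i)) (r i)) →
          ∀ i → ℓ (r (suc i)) ≡ n → Par (r (suc i)) (r i)
        go _ rec i refl
          with parent {r (suc i)} (λ eq → Br-¬Val2 (suc i) (all (suc i)) (subst Val2 (≡sym eq) (_ , _ , nv)))
             | climb i (all i) (all (suc i))
        ... | u , a | y , n , b , _ with only3 n u (proj₁ a)
        ... | inj₁ refl = ⊥-elim (Par-asym a (rec (Par-< a) (suc i) refl))
        ... | inj₂ (inj₁ refl) = a
        ... | inj₂ (inj₂ refl) with parent {y} (λ { refl → Br-¬Val2 i b (_ , _ , nv) })
        ... | t , a′ with Br-parent i (λ i _ → all i) b a′
        ... | inj₁ refl = ⊥-elim (Par-asym a a′)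
        ... | inj₂ (eq , _) = contradiction (≡sym eq) (N3.y≢z n)

      -- Bounds the index by the level, so that a finite search decides membership in the ray.
      ray-level : ∀ i → i ≤ ℓ (r i)
      ray-level zero = z≤n
      ray-level (suc i) = ≤-trans (s≤s (ray-level i)) (Par-< (ray-parent i))

      Ray? : ∀ x → Dec (∃ λ i → ⊤ × x ≡ r i)
      Ray? x = map′ (λ (i , _ , eq) → i , tt , eq) (λ { (i , _ , refl) → i , s≤s (ray-level i) , refl })
        (anyUpTo? (λ i → x ≟ r i) (suc (ℓ x)))

      Ray⁺? : ∀ x → Dec (∃ λ i → ⊤ × (x ≡ r i ⊎ x ≡ r (suc i)))
      Ray⁺? x = map′ (λ (i , _ , eq) → i , tt , inj₁ eq)
        (λ { (i , _ , inj₁ eq) → i , tt , eq ; (i , _ , inj₂ eq) → suc i , tt , eq }) (Ray? x)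

      -- The height `0` is an arbitrary choice: automorphisms respect branches of every height.
      open Coloured (λ _ → ⊤) (λ _ _ → tt) (λ {i} _ → all i) 0 Ray? Ray⁺?
        renaming (D≤2 to D≤2-if-root-fixed)

      open Scheme scheme using (Black)

      -- By `rise`, the level of the image of the ray drops at every step, which cannot go on
      -- forever.
      falls : ∀ A → (∀ {x} → Black x → Black (Au.f A x)) → Au.f A v ≢ v →
        ∀ i → i + ℓ (Au.f A (r i)) ≤ ℓ (Au.f A b)
      falls A pres fv≢v zero = ≤-refl
      falls A pres fv≢v (suc i) = ≤-trans (≤-reflexive (≡sym (+-suc i (ℓ (Au.f A (r (suc i)))))))
        (≤-trans (+-monoʳ-≤ i (Par-< (rise A pres fv≢v {i} tt))) (falls A pres fv≢v i))

      D≤2 : DistinguishingNumber≤2 G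
      D≤2 = D≤2-if-root-fixed λ A pres fv≢v →
        m+n≮m (ℓ (Au.f A b)) _ (falls A pres fv≢v (suc (ℓ (Au.f A b))))

    -- A finite ray with top `r h`

    module Finite (h : ℕ) (Good-h : Good h)
      (stop : (∀ w → r (suc h) ~ w → w ≢ r h → ¬ Br h w (r (suc h))) ⊎ ∃ (N2 (r (suc h)) (r h))) where

      Ray? : ∀ x → Dec (∃ λ i → i ≤ h × x ≡ r i)
      Ray? x = map′ (λ (i , lt , eq) → i , ≤-pred lt , eq) (λ (i , le , eq) → i , s≤s le , eq)
        (anyUpTo? (λ i → x ≟ r i) (suc h))

      Ray⁺? : ∀ x → Dec (∃ λ i → i ≤ h × (x ≡ r i ⊎ x ≡ r (suc i)))
      Ray⁺? x = map′ (λ (i , lt , eq) → i , ≤-pred lt , eq) (λ (i , le , eq) → i , s≤s le , eq)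
        (anyUpTo? (λ i → (x ≟ r i) ⊎-dec (x ≟ r (suc i))) (suc h))

      open Coloured (_≤ h) ≤-trans (Good-h _) h Ray? Ray⁺?
        renaming (D≤2 to D≤2-if-root-fixed)
      open Scheme scheme using (Black)

      module _ (A : Au) (pres : ∀ {x} → Black x → Black (Au.f A x)) (fv≢v : Au.f A v ≢ v) where
        open Au A

        up : Par (f (r h)) (f (r (suc h)))
        up = rise A pres fv≢v ≤-refl

        br : Br h (f (r h)) (f (r (suc h)))
        br = Br-f A h (Good-h h ≤-refl)

        -- A twin `y` of `f (r h)` carries a branch of height `h` at the same vertex; pulled back by
        -- `g`, it is a second such branch at `r (suc h)`.
        impossible : Black (f (r h)) → ⊥
        impossible (inj₁ (inj₁ eq)) = Br-≢v {h} br eq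
        impossible (inj₁ (inj₂ ray)) =
          ¬Ray-Br {h} br (λ eq → fv≢v (descend A pres h ≤-refl eq)) ray
        impossible (inj₂ (y , (t , _ , _ , same) , _)) = go stop
          where
          by : Br h y (f (r (suc h)))
          by = proj₁ (same _ up) br
          gy : r (suc h) ~ g y
          gy = preimage (~sym (Br~ h by))
          gy≢ : g y ≢ r h
          gy≢ eq = proj₁ t (trans (cong f (≡sym eq)) (fg y))
          go : (∀ w → r (suc h) ~ w → w ≢ r h → ¬ Br h w (r (suc h))) ⊎ ∃ (N2 (r (suc h)) (r h)) → ⊥
          go (inj₁ none) = none (g y) gy gy≢ (subst (Br h (g y)) (gf _) (Br-f (inv A) h by))
          -- Both neighbours of `f (r (suc h))` are its children, so it has no parent and is `v`;
          -- but `v` has the neighbour `a` of valence 2, while branch roots have valence 3.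
          go (inj₂ (z , n)) with f (r (suc h)) ≟ v
          ... | yes eq = both-nbs (subst (λ x → N2 x (f (r h)) (f z)) eq (N2-f n))
            where
            both-nbs : N2 v (f (r h)) (f z) → ⊥
            both-nbs m with N2-other n gy gy≢
            ... | gy≡z with trans (≡sym (fg y)) (cong f gy≡z)
            ... | refl with N2.only m a (N2.~y nv)
            ... | inj₁ eq = Br-¬Val2 h br (subst Val2 eq (_ , _ , na))
            ... | inj₂ eq = Br-¬Val2 h by (subst Val2 eq (_ , _ , na))
          ... | no ne with parent ne
          ... | u , a with N2.only (N2-f n) u (proj₁ a)
          ... | inj₁ refl = Par-asym up a
          ... | inj₂ refl = Par-asym (subst (λ x → Par x (f (r (suc h))))
                  (trans (≡sym (fg y)) (cong f (N2-other n gy gy≢))) (Tw-par t up)) a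

      D≤2 : DistinguishingNumber≤2 G
      D≤2 = D≤2-if-root-fixed λ A pres fv≢v → impossible A pres fv≢v (pres (inj₁ (inj₂ (h , ≤-refl , refl))))

    -- Exactly one further branch of height `h` together with a third edge would force `next` to
    -- follow that edge, and `good (suc h)` would hold.
    stop-cases : ∀ h → good h → ¬ good (suc h) →
      ((∀ w → r (suc h) ~ w → w ≢ r h → ¬ Br h w (r (suc h))) ⊎ ∃ (N2 (r (suc h)) (r h))) ⊎
      ∃₂ λ y w → N3 (r (suc h)) (r h) y w × Br h y (r (suc h)) × Br h w (r (suc h))
    stop-cases h g ¬g with ∃~? (λ y → ¬? (y ≟ r h) ×-dec Br? h y (r (suc h))) (r (suc h))
    ... | no none = inj₁ (inj₁ λ w e ne b → none (w , e , ne , b))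
    ... | yes (y , e , y≢ , b) with ∃~? (λ w → ¬? (w ≟ r h) ×-dec ¬? (w ≟ y)) (r (suc h))
    ... | no none = inj₁ (inj₂ (y , n2 (y≢ ∘ ≡sym) (~sym (Br~ h g)) e only))
      where
      only : ∀ w → r (suc h) ~ w → w ≡ r h ⊎ w ≡ y
      only w e with w ≟ r h | w ≟ y
      ... | yes eq | _ = inj₁ eq
      ... | no _ | yes eq = inj₂ eq
      ... | no ne | no ne′ = contradiction (w , e , ne , ne′) none
    ... | yes (w , e′ , w≢ , w≢y) with Br? h w (r (suc h))
    ... | yes b′ = inj₂ (y , w , n3 (y≢ ∘ ≡sym) (w≢ ∘ ≡sym) (w≢y ∘ ≡sym) (~sym (Br~ h g)) e e′ , b , b′)
    ... | no ¬b′ = ⊥-elim (¬g (subst (Br (suc h) (r (suc h))) (≡sym next≡w) (r h , y , n , g , b)))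
      where
      n : N3 (r (suc h)) w (r h) y
      n = n3 w≢ w≢y (y≢ ∘ ≡sym) e′ (~sym (Br~ h g)) e
      next≡w : r (suc (suc h)) ≡ w
      next≡w = next-unique h (r h) (r (suc h)) e′ w≢ ¬b′ λ u e u≢ ¬b →
        [ (λ eq → eq) , [ (λ eq → contradiction eq u≢) , (λ { refl → contradiction b ¬b }) ]′ ]′ (only3 n u e)

    stopped : ∀ h → Good h → ¬ good (suc h) → DistinguishingNumber≤2 G ⊎ Σ ℕ λ n → 2 ≤ n × (G ≅ S n)
    stopped h Good-h ¬g with stop-cases h (Good-h h ≤-refl) ¬g
    ... | inj₁ stop = inj₁ (Finite.D≤2 h Good-h stop)
    ... | inj₂ (y , w , n , b , b′) = inj₂ (suc (suc h) , s≤s (s≤s z≤n) ,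
        Exceptional.isomorphic (r (suc h)) h top top~ top-injective top-only top-Br)
      where
      top : Fin 3 → X
      top Fin.zero = r h
      top (Fin.suc Fin.zero) = y
      top (Fin.suc (Fin.suc Fin.zero)) = w
      top~ : ∀ i → r (suc h) ~ top i
      top~ Fin.zero = N3.~p n
      top~ (Fin.suc Fin.zero) = N3.~y n
      top~ (Fin.suc (Fin.suc Fin.zero)) = N3.~z n
      top-injective : ∀ i j → top i ≡ top j → i ≡ j
      top-injective Fin.zero Fin.zero _ = refl
      top-injective (Fin.suc Fin.zero) (Fin.suc Fin.zero) _ = refl
      top-injective (Fin.suc (Fin.suc Fin.zero)) (Fin.suc (Fin.suc Fin.zero)) _ = refl
      top-injective Fin.zero (Fin.suc Fin.zero) eq = contradiction eq (N3.p≢y n)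
      top-injective Fin.zero (Fin.suc (Fin.suc Fin.zero)) eq = contradiction eq (N3.p≢z n)
      top-injective (Fin.suc Fin.zero) (Fin.suc (Fin.suc Fin.zero)) eq = contradiction eq (N3.y≢z n)
      top-injective (Fin.suc Fin.zero) Fin.zero eq = contradiction (≡sym eq) (N3.p≢y n)
      top-injective (Fin.suc (Fin.suc Fin.zero)) Fin.zero eq = contradiction (≡sym eq) (N3.p≢z n)
      top-injective (Fin.suc (Fin.suc Fin.zero)) (Fin.suc Fin.zero) eq = contradiction (≡sym eq) (N3.y≢z n)
      top-only : ∀ u → r (suc h) ~ u → ∃ λ i → top i ≡ u
      top-only u e with only3 n u e
      ... | inj₁ refl = Fin.zero , refl
      ... | inj₂ (inj₁ refl) = Fin.suc Fin.zero , refl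
      ... | inj₂ (inj₂ refl) = Fin.suc (Fin.suc Fin.zero) , refl
      top-Br : ∀ i → Br h (top i) (r (suc h))
      top-Br Fin.zero = Good-h h ≤-refl
      top-Br (Fin.suc Fin.zero) = b
      top-Br (Fin.suc (Fin.suc Fin.zero)) = b′

    good? : ∀ i → Dec (good i)
    good? i = Br? i (r i) (r (suc i))

    bounded : ∀ i → ¬ good i → DistinguishingNumber≤2 G ⊎ Σ ℕ λ n → 2 ≤ n × (G ≅ S n)
    bounded i ¬g with least (λ i → ¬? (good? i)) i ¬g
    ... | zero , ¬g₀ , _ = contradiction good₀ ¬g₀
    ... | suc h , ¬g′ , below = stopped h (λ i le → decidable-stable (good? i) (below i (s≤s le))) ¬g′

    -- Whether the ray stops is undecidable. If the conclusion is refuted, `bounded` shows that no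
    -- index fails, and the infinite case applies.
    conclusion : ¬ ¬ (DistinguishingNumber≤2 G ⊎ Σ ℕ λ n → 2 ≤ n × (G ≅ S n))
    conclusion k = k (inj₁ (Infinite.D≤2 λ i → decidable-stable (good? i) (k ∘ bounded i)))

  -- Case distinction at the root

  Val2⇒N2 : ∀ {x y z} → Val2 x → x ~ y → x ~ z → y ≢ z → N2 x y z
  Val2⇒N2 {x} {y} {z} (_ , _ , n) ey ez y≢z = n2 y≢z ey ez only
    where
    only : ∀ w → x ~ w → w ≡ y ⊎ w ≡ z
    only w e with w ≟ y | w ≟ z
    ... | yes eq | _ = inj₁ eq
    ... | no _ | yes eq = inj₂ eq
    ... | no w≢y | no w≢z = ⊥-elim (N2-N3 n (n3 w≢y w≢z y≢z e ey ez))

  -- Without a third edge at `b` the connected graph would be a triangle, and no vertex would have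
  -- valence 3.
  triangle-exit : ∀ {a b u p q s} → N2 v a b → N2 a v b → b ~ a → N3 u p q s → ∃ λ c → N3 b v a c
  triangle-exit {a} {b} {u} nv na b~a n-u with ∃~? (λ c → ¬? (v ≟ c) ×-dec ¬? (a ≟ c)) b
  ... | yes (c , e , v≢c , a≢c) = c , n3 (~≢ (N2.~y nv)) v≢c a≢c (~sym (N2.~z nv)) b~a e
  ... | no none = ⊥-elim (no-valence-3 (inside (inj₁ refl) (conn v u)))
    where
    nb-b : N2 b v a
    nb-b = n2 (~≢ (N2.~y nv)) (~sym (N2.~z nv)) b~a only
      where
      only : ∀ w → b ~ w → w ≡ v ⊎ w ≡ a
      only w e with v ≟ w | a ≟ w
      ... | yes eq | _ = inj₁ (≡sym eq)
      ... | no _ | yes eq = inj₂ (≡sym eq)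
      ... | no ne | no ne′ = contradiction (w , e , ne , ne′) none
    Inside : X → Set
    Inside x = x ≡ v ⊎ x ≡ a ⊎ x ≡ b
    inside : ∀ {x y} → Inside x → Walk G x y → Inside y
    inside i Walk.here = i
    inside (inj₁ refl) (step e w) = inside (inj₂ (N2.only nv _ e)) w
    inside (inj₂ (inj₁ refl)) (step e w) = inside ([ inj₁ , inj₂ ∘ inj₂ ]′ (N2.only na _ e)) w
    inside (inj₂ (inj₂ refl)) (step e w) = inside ([ inj₁ , inj₂ ∘ inj₁ ]′ (N2.only nb-b _ e)) w
    no-valence-3 : Inside u → ⊥
    no-valence-3 (inj₁ refl) = N2-N3 nv n-u
    no-valence-3 (inj₂ (inj₁ refl)) = N2-N3 na n-u
    no-valence-3 (inj₂ (inj₂ refl)) = N2-N3 nb-b n-u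

  triangle-case : ∀ {a b u p q s} → N2 v a b → a ~ b → Val2 a → N3 u p q s → Type1 G v →
    ¬ ¬ (DistinguishingNumber≤2 G ⊎ Σ ℕ λ n → 2 ≤ n × (G ≅ S n))
  triangle-case {a} {b} nv a~b val n-u t1 =
    let na = Val2⇒N2 val (~sym (N2.~y nv)) a~b (~≢ (N2.~z nv))
        c , n-b = triangle-exit nv na (~sym a~b) n-u
    in Triangle.conclusion a b c nv na n-b t1

  valence-2 : ∀ {x} → HasValence G x 2 → Val2 x
  valence-2 (y ∷ z ∷ [] , (y≢z ∷ []) ∷ _ , refl , h) = y , z , n2 y≢z
    (Equivalence.from (h y) (here refl)) (Equivalence.from (h z) (there (here refl)))
    λ w e → pair (Equivalence.to (h w) e)
    where
    pair : ∀ {w} → w ∈ y ∷ z ∷ [] → w ≡ y ⊎ w ≡ z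
    pair (here eq) = inj₁ eq
    pair (there (here eq)) = inj₂ eq

  valence-3 : ∀ {x} → HasValence G x 3 → ∃ λ p → ∃₂ (N3 x p)
  valence-3 (p ∷ y ∷ z ∷ [] , (p≢y ∷ p≢z ∷ []) ∷ (y≢z ∷ []) ∷ _ , refl , h) = p , y , z , n3 p≢y p≢z y≢z
    (Equivalence.from (h p) (here refl)) (Equivalence.from (h y) (there (here refl)))
    (Equivalence.from (h z) (there (there (here refl))))

theorem5p1 : (G : Graph) → Connected G → MaxValence3 G →
    (v : V G) → HasValence G v 2 → Type1 G v →
    ¬ ¬ (DistinguishingNumber≤2 G ⊎ Σ ℕ λ n → 2 ≤ n × (G ≅ S n))
theorem5p1 G conn (mv , u , val-u) v val-v t1 = go (a ~? b ×-dec (Val2? a ⊎-dec Val2? b))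
  where
  open Rooted G conn mv v
  a = proj₁ (valence-2 val-v)
  b = proj₁ (proj₂ (valence-2 val-v))
  nv : N2 v a b
  nv = proj₂ (proj₂ (valence-2 val-v))
  n-u = proj₂ (proj₂ (proj₂ (valence-3 val-u)))
  go : Dec (a ~ b × (Val2 a ⊎ Val2 b)) → ¬ ¬ (DistinguishingNumber≤2 G ⊎ Σ ℕ λ n → 2 ≤ n × (G ≅ S n))
  go (no ¬tri) k = k (inj₁ (Generic.D≤2 a b nv t1 ¬tri))
  go (yes (e , inj₁ val)) = triangle-case nv e val n-u t1
  go (yes (e , inj₂ val)) = triangle-case (N2-swap nv) (~sym e) val n-u t1
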